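{- Let $n$, $m$, $h$ be positive integers and $d$ a positive divisor of $n$. Let $c, k_1, k_2$ be positive integers with $m = k_1 + (c-1)d + k_2$, $k_1 < d$, $k_2 < d$, $k_1 + k_2 > d$; let $H=\{j\cdot\tfrac{n}{d}: j=0,\dots,d-1\}$ be the subgroup of order $d$ of $\mathbb{Z}_n$, let $g\in\mathbb{Z}_n$, and let $j_0$ be an integer with $0\le j_0\le d-1$. Let $$B' = \left\{ j\cdot\tfrac{n}{d} : j=0,\dots,k_1-1\right\},\quad B'' = \left\{ cg + (j_0+j)\cdot\tfrac{n}{d} : j=0,\dots,k_2-1\right\},$$ and $B = B' \cup \bigcup_{i=1}^{c-1}(ig+H) \cup B''$, and assume $B$ has exactly $m$ elements (so $m\le n$). Assign to each element of $B$ an index: $0$ for elements of $B'$, $i$ for elements of $ig+H$ ($1\le i\le c-1$), and $c$ for elements of $B''$. Let $i_{\min}$ and $i_{\max}$ be the minimum and maximum of the sum of the indices of $h$ distinct elements of $B$, and for each integer $i$ let $h\hat{_i}B$ be the set of sums of $h$ distinct elements of $B$ whose indices sum to $i$. Assume that $g$ satisfies $i_{\max}\cdot g = i_{\min}\cdot g + \tfrac{n}{d}$ and that $B$ is special, i.e. one of $h\hat{_{i_{\max}}}B$, $h\hat{_{i_{\min}}}B$ is a subset of the other. Suppose moreover that $h \leq \max\{k_1,k_2\}$. Then $$|h\hat{\;}B| \geq u\hat{\;}(n,m,h) - 1;$$ furthermore, if equality holds, then one of the following holds: (i) $h=2$, $m-1$ is not a power of $2$, and $n$ is divisible by $2m-2$;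 (ii) $h=3$, $m=6$, and $n$ is divisible by $10$; (iii) $h$ is odd, $m+2$ is divisible by $h+2$, and $n$ is divisible by $hm-h^2$.
   Context: For a subset $A$ of $\mathbb{Z}_n$, $h\hat{\;}A$ denotes the set of sums of $h$ distinct elements of $A$. For positive integers $n,m,h$ with $m\le n$ and a positive divisor $e$ of $n$, write $m = c_e e + k_e$ with $c_e = \lceil m/e\rceil - 1$, $1\le k_e\le e$, let $H_e$ be the subgroup of order $e$ of $\mathbb{Z}_n$, and let $A_e(n,m) = \bigcup_{i=0}^{c_e-1}(i+H_e) \cup \{c_e + j\cdot\tfrac{n}{e} : j=0,\dots,k_e-1\}$. Then $u\hat{\;}(n,m,h) = \min\{ |h\hat{\;}A_e(n,m)| : e \text{ a positive divisor of } n\}$. -}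

module Defs where

open import Data.Nat using (ℕ; zero; suc; _+_; _*_; _∸_; _⊓_; _⊔_; NonZero; _≟_)
open import Data.Nat.DivMod using (_/_; _%_)
open import Data.Nat.Divisibility using (_∣?_)
open import Data.Nat.ListAction using (sum)
open import Data.List using (List; []; _∷_; _++_; map; concatMap; length; filter; foldr; deduplicate; upTo; applyUpTo)
open import Data.Product using (_×_; _,_; proj₁; proj₂)

choose : {A : Set} → ℕ → List A → List (List A)
choose zero    _        = [] ∷ []
choose (suc h) []       = []
choose (suc h) (x ∷ xs) = map (x ∷_) (choose h xs) ++ choose (suc h) xs

-- Minimum / maximum of a list (value 0 for the empty list; never used on [] here).
listMin : List ℕ → ℕ
listMin []       = 0
listMin (x ∷ xs) = foldr _⊓_ x xs

listMax : List ℕ → ℕ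
listMax []       = 0
listMax (x ∷ xs) = foldr _⊔_ x xs

-- Elements of ℤ_n are represented by their residues 0 … n-1 (natural numbers).
-- Restricted sumset h^A of a set A ⊆ ℤ_n given as a list of residues:
-- duplicates in the list are first removed, then all sums of h distinct
-- elements are taken mod n, and the resulting list of residues is deduplicated.
hHat : (n : ℕ) .{{_ : NonZero n}} → ℕ → List ℕ → List ℕ
hHat n h A = deduplicate _≟_ (map (λ s → sum s % n) (choose h (deduplicate _≟_ A)))

ceilDiv : ℕ → (e : ℕ) .{{_ : NonZero e}} → ℕ
ceilDiv m e = (m + e ∸ 1) / e

Ae : (n : ℕ) .{{_ : NonZero n}} → ℕ → (e : ℕ) .{{_ : NonZero e}} → List ℕ
Ae n m e =
  concatMap (λ i → map (λ j → (i + j * (n / e)) % n) (upTo e)) (upTo ce)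
  ++ map (λ j → (ce + j * (n / e)) % n) (upTo ke)
  where
  ce = ceilDiv m e ∸ 1
  ke = m ∸ ce * e

uHat : (n : ℕ) .{{_ : NonZero n}} → ℕ → ℕ → ℕ
uHat n m h =
  listMin (map (λ e' → length (hHat n h (Ae n m (suc e'))))
               (filter (λ e' → suc e' ∣? n) (upTo n)))

-- The set B of the theorem, as a list of (element mod n, index) pairs:
-- B' with index 0, ig + H with index i (1 ≤ i ≤ c-1), B'' with index c.
-- Here q stands for n/d.
Bidx : (n : ℕ) .{{_ : NonZero n}} → (q d c k₁ k₂ g j₀ : ℕ) → List (ℕ × ℕ)
Bidx n q d c k₁ k₂ g j₀ =
  map (λ j → ((j * q) % n , 0)) (upTo k₁)
  ++ concatMap (λ i → map (λ j → ((i * g + j * q) % n , i)) (upTo d))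
               (applyUpTo suc (c ∸ 1))
  ++ map (λ j → ((c * g + (j₀ + j) * q) % n , c)) (upTo k₂)

idxSum : List (ℕ × ℕ) → ℕ
idxSum s = sum (map proj₂ s)

eltSum : (n : ℕ) .{{_ : NonZero n}} → List (ℕ × ℕ) → ℕ
eltSum n s = sum (map proj₁ s) % n

-- Choices of h distinct elements of B (B's elements are pairwise distinct
-- under the hypothesis |B| = m, so positional combinations suffice).
hChoices : ℕ → List (ℕ × ℕ) → List (List (ℕ × ℕ))
hChoices h B = choose h B

hHatB : (n : ℕ) .{{_ : NonZero n}} → ℕ → List (ℕ × ℕ) → List ℕ
hHatB n h B = deduplicate _≟_ (map (eltSum n) (hChoices h B))

hHatIdx : (n : ℕ) .{{_ : NonZero n}} → ℕ → List (ℕ × ℕ) → ℕ → List ℕ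
hHatIdx n h B i =
  deduplicate _≟_ (map (eltSum n) (filter (λ s → idxSum s ≟ i) (hChoices h B)))

iMin : ℕ → List (ℕ × ℕ) → ℕ
iMin h B = listMin (map idxSum (hChoices h B))

iMax : ℕ → List (ℕ × ℕ) → ℕ
iMax h B = listMax (map idxSum (hChoices h B))

Bset : (n d : ℕ) .{{_ : NonZero n}} .{{_ : NonZero d}} → (c k₁ k₂ g j₀ : ℕ) → List (ℕ × ℕ)
Bset n d c k₁ k₂ g j₀ = Bidx n (n / d) d c k₁ k₂ g j₀

cardB : List (ℕ × ℕ) → ℕ
cardB B = length (deduplicate _≟_ (map proj₁ B))

module Submission where

-- A choice of h elements of B lies in the coset i g + H, where i is the sum of
-- the indices.  If it meets some coset partially, its sum can be moved through
-- an interval inside i g + H, and for i_min < i < i_max the whole of i g + H is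
-- reached.  Let t be the order of g modulo H; then t divides i_max - i_min, and
-- the subgroup generated by g and H has order t d ≥ m, so u^ ≤ t d.  Hence
-- nothing is left to prove unless t = i_max - i_min, in which case the only
-- rows that can be incomplete are those of i_min and i_max, and these lie in
-- the same coset.  Comparing the resulting count with the subgroups of order
-- at least m and with the interval A_1, where |h^A_1| ≤ h (m - h) + 1, settles
-- all parameters except those of (i)-(iii) and some with h, d even and k₁ = k₂;
-- in the latter the two end rows complement each other.

open import Defs
open import Data.List using (List; []; _∷_; [_]; _++_; map; concatMap; length; foldr; deduplicate; upTo; applyUpTo)
open import Data.List.Membership.Propositional using (_∈_; find)
open import Data.List.Membership.Propositional.Properties
  using (∈-map⁺; ∈-map⁻; ∈-++⁺ˡ; ∈-++⁺ʳ; ∈-++⁻; ∈-∃++; ∈-deduplicate⁺; ∈-deduplicate⁻;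
         ∈-upTo⁺; ∈-upTo⁻; ∈-filter⁺; ∈-concatMap⁻)
open import Data.List.Properties
  using (length-++; length-map; length-upTo; map-upTo; upTo-∷ʳ; applyUpTo-∷ʳ; concatMap-++; map-++; ++-identityʳ)
open import Data.List.Relation.Binary.Permutation.Propositional using (↭⇒↭ₛ)
open import Data.List.Relation.Binary.Permutation.Propositional.Properties using (shift; ↭-length)
import Data.List.Relation.Binary.Permutation.Setoid.Properties as Perm
open import Data.List.Relation.Binary.Sublist.Propositional using (_⊆_; []; _∷_; _∷ʳ_; minimum; ⊆-refl; ⊆-trans)
import Data.List.Relation.Binary.Sublist.Propositional.Properties as Sub
open import Data.List.Relation.Unary.All as All using (All; []; _∷_)
import Data.List.Relation.Unary.All.Properties as All
open import Data.List.Relation.Unary.AllPairs using ([]; _∷_)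
open import Data.List.Relation.Unary.Any using (here; there)
open import Data.List.Relation.Unary.Unique.Propositional using (Unique)
import Data.List.Relation.Unary.Unique.Propositional.Properties as Unique
open import Data.Nat
open import Data.List.Relation.Unary.Unique.DecPropositional.Properties _≟_ using (deduplicate-!)
open import Data.Nat.Coprimality using (coprime-/gcd; coprime-divisor)
open import Data.Nat.DivMod
open import Data.Nat.Divisibility
open import Data.Nat.GCD using (gcd; gcd[m,n]∣m; gcd[m,n]∣n; gcd[m,n]≢0)
open import Data.Nat.ListAction using (sum)
open import Data.Nat.ListAction.Properties using (sum-++; sum-↭)
open import Data.Nat.Primality using (prime[2]; euclidsLemma)
open import Data.Nat.Properties
open import Data.Nat.Tactic.RingSolver using (solve-∀)
open import Data.Product using (_×_; _,_; proj₁; proj₂; ∃)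
open import Data.Sum using (_⊎_; inj₁; inj₂; fromInj₁; fromInj₂)
open import Function using (_∘_)
open import Relation.Nullary using (¬_; Dec; yes; no; contradiction)
open import Relation.Binary.PropositionalEquality hiding ([_])

-- Call the coset i g + H row i, and count columns in steps of n/d. The engine is 1 + x z ≥ x + z
-- for x, z ≥ 1: choosing x of the d elements of a coset reaches 1 + x (d - x) consecutive columns,
-- hence all d of them when 0 < x < d; and h ≤ max{k₁, k₂} < d means that a choice never exhausts a
-- coset. The relation i_max g = i_min g + n/d puts the two end rows into one coset, one column
-- apart. With N = i_max - i_min and an end interval of w + 1 columns, the count is at least (N - 1)
-- d + w + 1, to be compared with u^ ≤ N d and u^ ≤ 1 + h (m - h). The first bound suffices if an
-- end row is complete, the second if the gaps between h, the two end lengths and d are large. When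
-- both fail, opposing inequalities squeeze these gaps to 0 or 1, or for h = 2 to a one-parameter
-- family; the exceptions are what survives of that short list.

unique-⊆-length : {A : Set} {xs ys : List A} → Unique xs → (∀ {z} → z ∈ xs → z ∈ ys) → length xs ≤ length ys
unique-⊆-length {xs = []} _ _ = z≤n
unique-⊆-length {A} {x ∷ xs} (x∉ ∷ u) sub with ∈-∃++ (sub (here refl))
... | as , bs , refl = ≤-trans (s≤s (unique-⊆-length u sub′)) (≤-reflexive eq)
  where
  sub′ : ∀ {z} → z ∈ xs → z ∈ as ++ bs
  sub′ z∈ with ∈-++⁻ as (sub (there z∈))
  ... | inj₁ p = ∈-++⁺ˡ p
  ... | inj₂ (here refl) = contradiction refl (All.lookup x∉ z∈)
  ... | inj₂ (there p) = ∈-++⁺ʳ as p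
  eq : suc (length (as ++ bs)) ≡ length (as ++ x ∷ bs)
  eq = trans (cong suc (length-++ as)) (trans (sym (+-suc (length as) _)) (sym (length-++ as)))

-- Extremal sums of h distinct natural numbers; `tri h` is 0 + 1 + ... + (h - 1).

tri : ℕ → ℕ
tri zero    = 0
tri (suc a) = tri a + a

private
  exists-≥ : ∀ h (xs : List ℕ) → (∀ {x} → x ∈ xs → x < h) ⊎ ∃ λ x → x ∈ xs × h ≤ x
  exists-≥ h [] = inj₁ λ ()
  exists-≥ h (x ∷ xs) with h ≤? x | exists-≥ h xs
  ... | yes p | _ = inj₂ (x , here refl , p)
  ... | no  p | inj₁ f = inj₁ λ { (here refl) → ≰⇒> p ; (there q) → f q }
  ... | no  p | inj₂ (y , y∈ , q) = inj₂ (y , there y∈ , q)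

-- By pigeonhole, h + 1 distinct naturals cannot all be below h; removing one that is at least h
-- gives the induction.
tri≤sum : ∀ h {xs} → Unique xs → length xs ≡ h → tri h ≤ sum xs
tri≤sum zero _ _ = z≤n
tri≤sum (suc h) {xs} u len with exists-≥ h xs
... | inj₁ f = contradiction (subst₂ _≤_ len (length-upTo h) (unique-⊆-length u (∈-upTo⁺ ∘ f))) (<⇒≱ ≤-refl)
... | inj₂ (x , x∈ , h≤x) with ∈-∃++ x∈
...   | as , bs , refl with Perm.Unique-resp-↭ (setoid ℕ) (↭⇒↭ₛ (shift x as bs)) u
...     | _ ∷ u′ = begin
  tri h + h               ≤⟨ +-mono-≤ (tri≤sum h u′ (suc-injective (trans (sym (↭-length (shift x as bs))) len))) h≤x ⟩
  sum (as ++ bs) + x      ≡⟨ +-comm _ x ⟩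
  x + sum (as ++ bs)      ≡⟨ sum-↭ (shift x as bs) ⟨
  sum (as ++ x ∷ bs)      ∎
  where open ≤-Reasoning

sum-reflect : ∀ M xs → All (_≤ M) xs → sum xs + sum (map (M ∸_) xs) ≡ length xs * M
sum-reflect M [] [] = refl
sum-reflect M (x ∷ xs) (p ∷ ps) = begin
  x + sum xs + (M ∸ x + sum (map (M ∸_) xs))   ≡⟨ lem x (sum xs) (M ∸ x) _ ⟩
  x + (M ∸ x) + (sum xs + sum (map (M ∸_) xs)) ≡⟨ cong₂ _+_ (m+[n∸m]≡n p) (sum-reflect M xs ps) ⟩
  M + length xs * M                            ∎
  where
  open ≡-Reasoning
  lem : ∀ a b c d → a + b + (c + d) ≡ a + c + (b + d)
  lem = solve-∀

unique-map-∸ : ∀ M {xs} → All (_≤ M) xs → Unique xs → Unique (map (M ∸_) xs)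
unique-map-∸ M [] [] = []
unique-map-∸ M (p ∷ ps) (x∉ ∷ u) =
  All.map⁺ (All.zipWith (λ { (q , x≢y) eq → x≢y (∸-cancelˡ-≡ p q eq) }) (ps , x∉)) ∷ unique-map-∸ M ps u

tri+tri : ∀ h → tri h + tri h + h ≡ h * h
tri+tri zero = refl
tri+tri (suc h) = trans (lem h (tri h)) (trans (cong (λ z → z + (1 + h + h)) (tri+tri h)) (lem₂ h))
  where
  lem : ∀ h t → (t + h) + (t + h) + suc h ≡ t + t + h + (1 + h + h)
  lem = solve-∀
  lem₂ : ∀ h → h * h + (1 + h + h) ≡ suc h * suc h
  lem₂ = solve-∀

-- Reflecting x to M - x, with M the largest admissible value, reduces this to `tri≤sum`.
sum≤tri : ∀ h z {xs} → Unique xs → length xs ≡ h → All (_< h + z) xs → sum xs ≤ tri h + h * z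
sum≤tri zero z {[]} u len a = z≤n
sum≤tri (suc h) z {xs} u len a = +-cancelʳ-≤ (tri (suc h)) _ _ (begin
  sum xs + tri (suc h)                 ≤⟨ +-monoʳ-≤ (sum xs) (tri≤sum (suc h) (unique-map-∸ (h + z) a′ u) (trans (length-map _ xs) len)) ⟩
  sum xs + sum (map (h + z ∸_) xs)     ≡⟨ sum-reflect (h + z) xs a′ ⟩
  length xs * (h + z)                  ≡⟨ cong (_* (h + z)) len ⟩
  suc h * (h + z)                      ≡⟨ lem₁ h z ⟩
  h * h + h + suc h * z                ≡⟨ cong (λ y → y + h + suc h * z) (sym (tri+tri h)) ⟩
  tri h + tri h + h + h + suc h * z    ≡⟨ lem₂ (tri h) h (suc h * z) ⟩
  tri (suc h) + suc h * z + tri (suc h) ∎)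
  where
  open ≤-Reasoning
  a′ : All (_≤ h + z) xs
  a′ = All.map s≤s⁻¹ a
  lem₁ : ∀ h z → suc h * (h + z) ≡ h * h + h + suc h * z
  lem₁ = solve-∀
  lem₂ : ∀ t h y → t + t + h + h + y ≡ t + h + y + (t + h)
  lem₂ = solve-∀

-- Choices as sublists, extrema of lists, and the sums attained inside a run.

choose-⊆ : {A : Set} {h : ℕ} {xs s : List A} → s ∈ choose h xs → s ⊆ xs × length s ≡ h
choose-⊆ {h = zero} {xs} (here refl) = minimum xs , refl
choose-⊆ {h = suc h} {x ∷ xs} s∈ with ∈-++⁻ (map (x ∷_) (choose h xs)) s∈
... | inj₁ p with ∈-map⁻ (x ∷_) p
...   | s′ , s′∈ , refl with choose-⊆ s′∈
...     | sub , len = refl ∷ sub , cong suc len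
choose-⊆ {h = suc h} {x ∷ xs} s∈ | inj₂ p with choose-⊆ p
... | sub , len = x ∷ʳ sub , len

⊆-choose : {A : Set} {xs s : List A} → s ⊆ xs → s ∈ choose (length s) xs
⊆-choose [] = here refl
⊆-choose {s = []} (x ∷ʳ p) = here refl
⊆-choose {s = y ∷ s} (x ∷ʳ p) = ∈-++⁺ʳ (map (x ∷_) (choose (length s) _)) (⊆-choose p)
⊆-choose (refl ∷ p) = ∈-++⁺ˡ (∈-map⁺ _ (⊆-choose p))

listMin-≤ : ∀ {v} xs → v ∈ xs → listMin xs ≤ v
listMin-≤ (x ∷ xs) = go xs
  where
  go : ∀ {v} ys → v ∈ x ∷ ys → foldr _⊓_ x ys ≤ v
  go [] (here refl) = ≤-refl
  go (y ∷ ys) (here refl) = ≤-trans (m⊓n≤n y _) (go ys (here refl))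
  go (y ∷ ys) (there (here refl)) = m⊓n≤m y _
  go (y ∷ ys) (there (there p)) = ≤-trans (m⊓n≤n y _) (go ys (there p))

listMin-glb : ∀ {v w} xs → w ∈ xs → (∀ {x} → x ∈ xs → v ≤ x) → v ≤ listMin xs
listMin-glb {v} (x ∷ xs) _ = go xs
  where
  go : ∀ ys → (∀ {y} → y ∈ x ∷ ys → v ≤ y) → v ≤ foldr _⊓_ x ys
  go [] f = f (here refl)
  go (y ∷ ys) f = ⊓-glb (f (there (here refl))) (go ys λ { (here p) → f (here p) ; (there p) → f (there (there p)) })

listMax-≥ : ∀ {v} xs → v ∈ xs → v ≤ listMax xs
listMax-≥ (x ∷ xs) = go xs
  where
  go : ∀ {v} ys → v ∈ x ∷ ys → v ≤ foldr _⊔_ x ys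
  go [] (here refl) = ≤-refl
  go (y ∷ ys) (here refl) = ≤-trans (go ys (here refl)) (m≤n⊔m y _)
  go (y ∷ ys) (there (here refl)) = m≤m⊔n y _
  go (y ∷ ys) (there (there p)) = ≤-trans (go ys (there p)) (m≤n⊔m y _)

listMax-lub : ∀ {v w} xs → w ∈ xs → (∀ {x} → x ∈ xs → x ≤ v) → listMax xs ≤ v
listMax-lub {v} (x ∷ xs) _ = go xs
  where
  go : ∀ ys → (∀ {y} → y ∈ x ∷ ys → y ≤ v) → foldr _⊔_ x ys ≤ v
  go [] f = f (here refl)
  go (y ∷ ys) f = ⊔-lub (f (there (here refl))) (go ys λ { (here p) → f (here p) ; (there p) → f (there (there p)) })

sum-⊆ : {A : Set} (φ : A → ℕ) {s xs : List A} → s ⊆ xs → sum (map φ s) ≤ sum (map φ xs)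
sum-⊆ φ [] = z≤n
sum-⊆ φ (y ∷ʳ p) = ≤-trans (sum-⊆ φ p) (m≤n+m _ (φ y))
sum-⊆ φ (refl ∷ p) = +-monoʳ-≤ (φ _) (sum-⊆ φ p)

sum-All-≤ : {A : Set} (φ : A → ℕ) (v : ℕ) {xs : List A} → All (λ x → φ x ≤ v) xs → sum (map φ xs) ≤ length xs * v
sum-All-≤ φ v [] = z≤n
sum-All-≤ φ v (p ∷ ps) = +-mono-≤ p (sum-All-≤ φ v ps)

-- No value between the extreme sums is skipped. The choice is greedy: an offset of at least the
-- current excess z allows the largest element, which uses up z of it; a smaller offset can do
-- without that element.
subset-of-upTo : ∀ a z o → o ≤ a * z → ∃ λ s → s ⊆ upTo (a + z) × length s ≡ a × sum s ≡ tri a + o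
subset-of-upTo zero z .0 z≤n = [] , minimum _ , refl , refl
subset-of-upTo (suc a) zero o o≤ with subset-of-upTo a zero o (≤-trans o≤ ≤-refl)
... | s , sub , len , eq = s ++ [ a + 0 ] , subst (s ++ [ a + 0 ] ⊆_) (upTo-∷ʳ (a + 0)) (Sub.++⁺ sub ⊆-refl)
    , trans (length-++ s) (trans (+-comm (length s) 1) (cong suc len))
    , trans (sum-++ s _) (trans (cong (_+ (a + 0 + 0)) eq) (lem (tri a) a o))
  where
  lem : ∀ t a o → t + o + (a + 0 + 0) ≡ t + a + o
  lem = solve-∀
subset-of-upTo (suc a) (suc z) o o≤ with suc z ≤? o
... | yes z<o with subset-of-upTo a (suc z) (o ∸ suc z) (m≤n+o⇒m∸n≤o o (suc z) o≤)
...   | s , sub , len , eq = s ++ [ a + suc z ] , subst (s ++ [ a + suc z ] ⊆_) (upTo-∷ʳ (a + suc z)) (Sub.++⁺ sub ⊆-refl)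
    , trans (length-++ s) (trans (+-comm (length s) 1) (cong suc len))
    , trans (sum-++ s _) (trans (cong (_+ (a + suc z + 0)) eq) (trans (lem (tri a) a (o ∸ suc z) (suc z)) (cong (tri a + a +_) (m∸n+n≡m z<o))))
  where
  lem : ∀ t a o z → t + o + (a + z + 0) ≡ t + a + (o + z)
  lem = solve-∀
subset-of-upTo (suc a) (suc z) o o≤ | no z≮o with subset-of-upTo (suc a) z o (≤-trans (s≤s⁻¹ (≰⇒> z≮o)) (m≤m+n z (a * z)))
... | s , sub , len , eq = s , ⊆-trans sub (subst (upTo (suc a + z) ⊆_) e (Sub.++⁺ʳ [ suc a + z ] ⊆-refl)) , len , eq
  where
  e : upTo (suc a + z) ++ [ suc a + z ] ≡ upTo (suc a + suc z)
  e = trans (upTo-∷ʳ (suc a + z)) (cong upTo (sym (+-suc (suc a) z)))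

-- Upper bounds for u^ from single sets A_e.

module _ (n : ℕ) .{{_ : NonZero n}} where

  uHat-≤ : ∀ m h e → suc e ∣ n → uHat n m h ≤ length (hHat n h (Ae n m (suc e)))
  uHat-≤ m h e e∣n =
    listMin-≤ _ (∈-map⁺ _ (∈-filter⁺ (λ e′ → suc e′ ∣? n) (∈-upTo⁺ (∣⇒≤ e∣n)) e∣n))

  length-hHat-≤ : ∀ h A ys →
    (∀ s → Unique s → length s ≡ h → All (_∈ A) s → sum s % n ∈ ys) →
    length (hHat n h A) ≤ length ys
  length-hHat-≤ h A ys f = unique-⊆-length (deduplicate-! _) sub
    where
    sub : ∀ {r} → r ∈ hHat n h A → r ∈ ys
    sub r∈ with ∈-map⁻ _ (∈-deduplicate⁻ _≟_ _ r∈)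
    ... | s , s∈ , refl with choose-⊆ s∈
    ...   | s⊆ , len = f s (Unique-⊆ s⊆ (deduplicate-! A)) len
                         (Sub.All-resp-⊆ s⊆ (All.tabulate (∈-deduplicate⁻ _≟_ A)))
      where
      Unique-⊆ : {xs ys : List ℕ} → xs ⊆ ys → Unique ys → Unique xs
      Unique-⊆ [] u = u
      Unique-⊆ (y ∷ʳ p) (_ ∷ u) = Unique-⊆ p u
      Unique-⊆ (refl ∷ p) (x∉ ∷ u) = Sub.All-resp-⊆ p x∉ ∷ Unique-⊆ p u

  ∈-Ae⁻ : ∀ m e .{{_ : NonZero e}} {x} → x ∈ Ae n m e →
    (∃ λ i → ∃ λ j → i < ceilDiv m e ∸ 1 × j < e × x ≡ (i + j * (n / e)) % n)
    ⊎ (∃ λ j → j < m ∸ (ceilDiv m e ∸ 1) * e × x ≡ (ceilDiv m e ∸ 1 + j * (n / e)) % n)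
  ∈-Ae⁻ m e x∈ with ∈-++⁻ (concatMap _ (upTo (ceilDiv m e ∸ 1))) x∈
  ... | inj₁ p with find (∈-concatMap⁻ _ {xs = upTo (ceilDiv m e ∸ 1)} p)
  ...   | i , i∈ , x∈′ with ∈-map⁻ _ x∈′
  ...     | j , j∈ , refl = inj₁ (i , j , ∈-upTo⁻ i∈ , ∈-upTo⁻ j∈ , refl)
  ∈-Ae⁻ m e x∈ | inj₂ p with ∈-map⁻ _ p
  ... | j , j∈ , refl = inj₂ (j , ∈-upTo⁻ j∈ , refl)

  ∣sum : ∀ {k} xs → All (k ∣_) xs → k ∣ sum xs
  ∣sum [] [] = _ ∣0
  ∣sum (x ∷ xs) (p ∷ ps) = ∣m∣n⇒∣m+n p (∣sum xs ps)

  -- A_e lies in the subgroup of order e as soon as m ≤ e.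
  uHat-≤-subgroup : ∀ m h e → 1 ≤ m → m ≤ e → e ∣ n → uHat n m h ≤ e
  uHat-≤-subgroup (suc m) h (suc e) _ m≤e e∣n = ≤-trans (uHat-≤ (suc m) h e e∣n)
    (≤-trans (length-hHat-≤ h _ (map (_* q) (upTo (suc e))) sub)
             (≤-reflexive (trans (length-map (_* q) (upTo (suc e))) (length-upTo (suc e)))))
    where
    q = n / suc e
    n≡ : n ≡ suc e * q
    n≡ = sym (m*[n/m]≡n e∣n)
    q∣n : q ∣ n
    q∣n = divides (suc e) n≡
    ceil≡1 : ceilDiv (suc m) (suc e) ≡ 1
    ceil≡1 = trans (+-distrib-/-∣ʳ m ∣-refl) (cong₂ _+_ (m<n⇒m/n≡0 m≤e) (n/n≡1 (suc e)))
    q∣ : ∀ {x} → x ∈ Ae n (suc m) (suc e) → q ∣ x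
    q∣ x∈ with ∈-Ae⁻ (suc m) (suc e) x∈
    ... | inj₁ (i , j , i< , _) = contradiction (subst (λ z → i < z ∸ 1) ceil≡1 i<) λ ()
    ... | inj₂ (j , j< , refl) =
      subst (λ z → q ∣ (z ∸ 1 + j * q) % n) (sym ceil≡1) (%-presˡ-∣ (n∣m*n j) q∣n)
    sub : ∀ s → Unique s → length s ≡ h → All (_∈ Ae n (suc m) (suc e)) s → sum s % n ∈ map (_* q) (upTo (suc e))
    sub s _ _ a with %-presˡ-∣ (∣sum s (All.map q∣ a)) q∣n
    ... | divides k eq = subst (_∈ map (_* q) (upTo (suc e))) (sym eq)
      (∈-map⁺ (_* q) (∈-upTo⁺ (*-cancelʳ-< q k (suc e) (subst₂ _<_ eq n≡ (m%n<n (sum s) n)))))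

  -- Uses e = 1: elements of A_1 have representatives below m = h + z, so sums of h distinct ones
  -- lie between `tri h` and `tri h + h * z`.
  uHat-≤-interval : ∀ h z → uHat n (h + z) h ≤ suc (h * z)
  uHat-≤-interval h z = ≤-trans (uHat-≤ (h + z) h 0 (1∣ n))
    (≤-trans (length-hHat-≤ h _ (map (λ o → (tri h + o) % n) (upTo (suc (h * z)))) sub)
             (≤-reflexive (trans (length-map (λ o → (tri h + o) % n) (upTo (suc (h * z)))) (length-upTo (suc (h * z))))))
    where
    ceil≡ : ceilDiv (h + z) 1 ≡ h + z
    ceil≡ = trans (n/1≡n _) (m+n∸n≡m (h + z) 1)
    j≡0 : ∀ {j} → j < 1 → j ≡ 0
    j≡0 (s≤s z≤n) = refl
    small : ∀ {x} → x ∈ Ae n (h + z) 1 → x < h + z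
    small x∈ with ∈-Ae⁻ (h + z) 1 x∈
    ... | inj₁ (i , j , i< , j< , refl) with j≡0 j<
    ...   | refl = ≤-<-trans (m%n≤m _ n) (≤-trans (s≤s (≤-reflexive (+-identityʳ i)))
                     (≤-trans i< (≤-trans (m∸n≤m _ 1) (≤-reflexive ceil≡))))
    small x∈ | inj₂ (j , j< , refl) rewrite ceil≡ = ≤-<-trans (m%n≤m _ n) (lem (h + z) j j<)
      where
      lem : ∀ m j → j < m ∸ (m ∸ 1) * 1 → m ∸ 1 + j * (n / 1) < m
      lem (suc m) j j< with j≡0 (subst (j <_) (trans (cong (suc m ∸_) (*-identityʳ m)) (m+n∸n≡m 1 m)) j<)
      ... | refl = s≤s (≤-reflexive (+-identityʳ m))
    sub : ∀ s → Unique s → length s ≡ h → All (_∈ Ae n (h + z) 1) s →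
          sum s % n ∈ map (λ o → (tri h + o) % n) (upTo (suc (h * z)))
    sub s u len a = subst (_∈ map (λ o → (tri h + o) % n) (upTo (suc (h * z))))
      (cong (_% n) (m+[n∸m]≡n (tri≤sum h u len)))
      (∈-map⁺ _ (∈-upTo⁺ (s≤s (m≤n+o⇒m∸n≤o (sum s) (tri h) (sum≤tri h z u len (All.map small a))))))

module _ (n : ℕ) .{{_ : NonZero n}} where

  +-cong-% : ∀ {x x′ y y′} → x % n ≡ x′ % n → y % n ≡ y′ % n → (x + y) % n ≡ (x′ + y′) % n
  +-cong-% {x} {x′} {y} {y′} p r =
    trans (%-distribˡ-+ x y n) (trans (cong₂ (λ a b → (a + b) % n) p r) (sym (%-distribˡ-+ x′ y′ n)))

  -- Congruence is handled by adding multiples of n on both sides, which avoids subtraction in ℕ.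
  %-≡⇐ : ∀ {x y} u v → x + u * n ≡ y + v * n → x % n ≡ y % n
  %-≡⇐ {x} {y} u v eq =
    trans (sym ([m+kn]%n≡m%n x u n)) (trans (cong (_% n) eq) ([m+kn]%n≡m%n y v n))

  %-≡⇒ : ∀ {x y} → x % n ≡ y % n → ∃ λ u → ∃ λ v → x + u * n ≡ y + v * n
  %-≡⇒ {x} {y} eq = y / n , x / n , (begin
    x + (y / n) * n                       ≡⟨ cong (_+ (y / n) * n) (m≡m%n+[m/n]*n x n) ⟩
    x % n + (x / n) * n + (y / n) * n     ≡⟨ cong (λ z → z + (x / n) * n + (y / n) * n) eq ⟩
    y % n + (x / n) * n + (y / n) * n     ≡⟨ lem (y % n) _ _ ⟩
    y % n + (y / n) * n + (x / n) * n     ≡⟨ cong (_+ (x / n) * n) (m≡m%n+[m/n]*n y n) ⟨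
    y + (x / n) * n                       ∎)
    where
    open ≡-Reasoning
    lem : ∀ a b c → a + b + c ≡ a + c + b
    lem = solve-∀

-- This is (x - 1)(z - 1) ≥ 0. It is applied with x elements chosen out of x + z, where 1 + x z sums
-- are available.
suc-*-≥ : ∀ {x z} → 1 ≤ x → 1 ≤ z → x + z ≤ suc (x * z)
suc-*-≥ {suc x} {suc z} _ _ = ≤-trans (m≤m+n _ (x * z)) (≤-reflexive (lem x z))
  where
  lem : ∀ x z → suc x + suc z + x * z ≡ suc (suc x * suc z)
  lem = solve-∀

-- Intervals of element sums with a prescribed index sum.

module Selections (n : ℕ) .{{_ : NonZero n}} (q g : ℕ) where

  -- From X one can choose a elements with index sum I whose element sums
  -- run through I g + s q, I g + (s + 1) q, …, I g + (s + w) q.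
  record Sel (X : List (ℕ × ℕ)) (a I s w : ℕ) : Set where
    constructor mkSel
    field
      select : ∀ o → o ≤ w →
        ∃ λ S → S ⊆ X × length S ≡ a × idxSum S ≡ I × eltSum n S ≡ (I * g + (s + o) * q) % n

  open Sel public

  Sel-∅ : ∀ X → Sel X 0 0 0 0
  Sel-∅ X = mkSel λ { .0 z≤n → [] , minimum X , refl , refl , refl }

  Sel-cast : ∀ {X a a′ I I′ s w} → a ≡ a′ → I ≡ I′ → Sel X a I s w → Sel X a′ I′ s w
  Sel-cast refl refl sel = sel

  Sel-resp : ∀ {X Y a I s w} → X ≡ Y → Sel X a I s w → Sel Y a I s w
  Sel-resp refl sel = sel

  Sel-++ : ∀ {X Y a b I J s t v w} → Sel X a I s v → Sel Y b J t w → Sel (X ++ Y) (a + b) (I + J) (s + t) (v + w)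
  select (Sel-++ {X} {Y} {a} {b} {I} {J} {s} {t} {v} {w} selX selY) o o≤
    -- X takes as much of the offset as its width allows and Y the remainder, so the two intervals
    -- join without a gap.
    with select selX (o ⊓ v) (m⊓n≤n o v) | select selY (o ∸ v) (m≤n+o⇒m∸n≤o o v o≤)
  ... | S , S⊆ , lS , iS , eS | R , R⊆ , lR , iR , eR =
    S ++ R , Sub.++⁺ S⊆ R⊆
    , trans (length-++ S) (cong₂ _+_ lS lR)
    , trans (trans (cong sum (map-++ proj₂ S R)) (sum-++ (map proj₂ S) _)) (cong₂ _+_ iS iR)
    , (begin
      sum (map proj₁ (S ++ R)) % n                                   ≡⟨ cong (_% n) (trans (cong sum (map-++ proj₁ S R)) (sum-++ (map proj₁ S) _)) ⟩
      (sum (map proj₁ S) + sum (map proj₁ R)) % n                    ≡⟨ +-cong-% n eS eR ⟩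
      (I * g + (s + o ⊓ v) * q + (J * g + (t + (o ∸ v)) * q)) % n    ≡⟨ cong (_% n) (lem I J g q s t (o ⊓ v) (o ∸ v)) ⟩
      ((I + J) * g + (s + t + (o ⊓ v + (o ∸ v))) * q) % n            ≡⟨ cong (λ z → ((I + J) * g + (s + t + z) * q) % n) (m⊓n+m∸n o v) ⟩
      ((I + J) * g + (s + t + o) * q) % n                            ∎)
    where
    open ≡-Reasoning
    lem : ∀ I J g q s t x y → I * g + (s + x) * q + (J * g + (t + y) * q) ≡ (I + J) * g + (s + t + (x + y)) * q
    lem = solve-∀
    m⊓n+m∸n : ∀ m n → m ⊓ n + (m ∸ n) ≡ m
    m⊓n+m∸n m n with ≤-total m n
    ... | inj₁ m≤n = trans (cong₂ _+_ (m≤n⇒m⊓n≡m m≤n) (m≤n⇒m∸n≡0 m≤n)) (+-identityʳ m)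
    ... | inj₂ n≤m = trans (cong (_+ (m ∸ n)) (m≥n⇒m⊓n≡n n≤m)) (m+[n∸m]≡n n≤m)

  block : ℕ → ℕ → ℕ → List (ℕ × ℕ)
  block i j₀ k = map (λ j → ((i * g + (j₀ + j) * q) % n , i)) (upTo k)

  Sel-block : ∀ i j₀ a z {k} → a + z ≡ k → Sel (block i j₀ k) a (a * i) (a * j₀ + tri a) (a * z)
  select (Sel-block i j₀ a z refl) o o≤ with subset-of-upTo a z o o≤
  ... | s , s⊆ , refl , eq =
    map f s , Sub.map⁺ f s⊆ , length-map f s , idx s
    , trans (elt s) (cong (λ y → (length s * i * g + y * q) % n) (trans (cong (length s * j₀ +_) eq) (sym (+-assoc (length s * j₀) _ o))))
    where
    f : ℕ → ℕ × ℕ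
    f j = ((i * g + (j₀ + j) * q) % n , i)
    idx : ∀ s → idxSum (map f s) ≡ length s * i
    idx [] = refl
    idx (x ∷ s) = cong (i +_) (idx s)
    elt : ∀ s → eltSum n (map f s) ≡ (length s * i * g + (length s * j₀ + sum s) * q) % n
    elt [] = refl
    elt (x ∷ s) = trans (+-cong-% n (m%n%n≡m%n (i * g + (j₀ + x) * q) n) (elt s))
                        (cong (_% n) (lem i g j₀ x q (length s) (sum s)))
      where
      lem : ∀ i g j₀ x q l t → i * g + (j₀ + x) * q + (l * i * g + (l * j₀ + t) * q)
                             ≡ (i + l * i) * g + (j₀ + l * j₀ + (x + t)) * q
      lem = solve-∀

  cosets : ℕ → ℕ → List (ℕ × ℕ)
  cosets d C = concatMap (λ i → block i 0 d) (applyUpTo suc C)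

  cosets-suc : ∀ d C → cosets d (suc C) ≡ cosets d C ++ block (suc C) 0 d
  cosets-suc d C = begin
    cosets d (suc C)                                            ≡⟨ cong (concatMap bl) (applyUpTo-∷ʳ suc C) ⟨
    concatMap bl (applyUpTo suc C ++ [ suc C ])                 ≡⟨ concatMap-++ bl (applyUpTo suc C) _ ⟩
    cosets d C ++ (block (suc C) 0 d ++ [])                     ≡⟨ cong (cosets d C ++_) (++-identityʳ _) ⟩
    cosets d C ++ block (suc C) 0 d                             ∎
    where
    open ≡-Reasoning
    bl : ℕ → List (ℕ × ℕ)
    bl i = block i 0 d

  Sel-first : ∀ {d} C a z → a + z ≡ d → ∃ λ s → Sel (cosets d (suc C)) a a s (a * z)
  Sel-first C a z e = _ , subst (Sel _ a a _) (+-identityʳ _)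
    (Sel-cast (+-identityʳ a) (trans (+-identityʳ _) (*-identityʳ a)) (Sel-++ (Sel-block 1 0 a z e) (Sel-∅ _)))

  Sel-last : ∀ {d} C a z → a + z ≡ d → ∃ λ s → Sel (cosets d (suc C)) a (a * suc C) s (a * z)
  Sel-last {d} C a z e = _ , Sel-resp (sym (cosets-suc d C))
    (Sel-++ (Sel-∅ (cosets d C)) (Sel-block (suc C) 0 a z e))

  -- Two neighbouring cosets suffice for any index sum: once I exceeds a times the last index but
  -- one, b elements come from the last coset and a - b from the one before. Since 0 < b < d, the
  -- last coset alone already supplies d consecutive columns.
  Sel-cosets : ∀ {d} C a I → 1 ≤ a → a < d → a ≤ I → I ≤ a * suc C →
    ∃ λ s → ∃ λ w → d ≤ suc w × Sel (cosets d (suc C)) a I s w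
  Sel-cosets {d} zero a I 1≤a a<d a≤I I≤ with Sel-first 0 a (d ∸ a) (m+[n∸m]≡n (<⇒≤ a<d))
  ... | s , sel = s , a * (d ∸ a)
    , ≤-trans (≤-reflexive (sym (m+[n∸m]≡n (<⇒≤ a<d)))) (suc-*-≥ 1≤a (m<n⇒0<n∸m a<d))
    , Sel-cast refl (≤-antisym a≤I (≤-trans I≤ (≤-reflexive (*-identityʳ a)))) sel
  Sel-cosets {d} (suc C) a I 1≤a a<d a≤I I≤ with I ≤? a * suc C
  ... | yes I≤′ with Sel-cosets C a I 1≤a a<d a≤I I≤′
  ...   | s , w , d≤ , sel = _ , w + 0 , ≤-trans d≤ (s≤s (m≤m+n w 0))
    , Sel-resp (sym (cosets-suc d (suc C)))
        (Sel-cast (+-identityʳ a) (+-identityʳ I) (Sel-++ sel (Sel-∅ _)))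
  Sel-cosets {d} (suc C) a I 1≤a a<d a≤I I≤ | no I≰ = _ , _ , d≤
    , Sel-resp (sym (cosets-suc d (suc C)))
        (Sel-cast (m∸n+n≡m b≤a) eq
          (Sel-++ (proj₂ (Sel-last C (a ∸ b) (d ∸ (a ∸ b)) (m+[n∸m]≡n (≤-trans (m∸n≤m a b) (<⇒≤ a<d)))))
                  (Sel-block (suc (suc C)) 0 b (d ∸ b) (m+[n∸m]≡n (<⇒≤ b<d)))))
    where
    b = I ∸ a * suc C
    I≡ : a * suc C + b ≡ I
    I≡ = m+[n∸m]≡n (<⇒≤ (≰⇒> I≰))
    b≤a : b ≤ a
    b≤a = +-cancelˡ-≤ (a * suc C) b a (≤-trans (≤-reflexive I≡) (≤-trans I≤ (≤-reflexive (trans (*-suc a (suc C)) (+-comm a _)))))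
    b<d : b < d
    b<d = ≤-<-trans b≤a a<d
    d≤ : d ≤ suc ((a ∸ b) * (d ∸ (a ∸ b)) + b * (d ∸ b))
    d≤ = ≤-trans (≤-reflexive (sym (m+[n∸m]≡n (<⇒≤ b<d))))
         (≤-trans (suc-*-≥ (m<n⇒0<n∸m (≰⇒> I≰)) (m<n⇒0<n∸m b<d)) (s≤s (m≤n+m _ _)))
    eq : (a ∸ b) * suc C + b * suc (suc C) ≡ I
    eq = trans (lem (a ∸ b) b C) (trans (cong (λ y → y * suc C + b) (m∸n+n≡m b≤a)) I≡)
      where
      lem : ∀ x b C → x * suc C + b * suc (suc C) ≡ (x + b) * suc C + b
      lem = solve-∀

-- The set B with C = c - 1 complete cosets, and the rows of its sumset.

module IndexedSums (n : ℕ) .{{_ : NonZero n}} (q d : ℕ) .{{_ : NonZero d}} (n≡ : n ≡ d * q)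
  (g j₀ C k₁ k₂ h : ℕ) where

  open Selections n q g

  B : List (ℕ × ℕ)
  B = Bidx n q d (suc C) k₁ k₂ g j₀

  -- The coset I g + H is contained in the sumset.
  Full : ℕ → Set
  Full I = ∀ j → (I * g + j * q) % n ∈ hHatB n h B

  Sel⇒∈ : ∀ {I s w} → Sel B h I s w → ∀ o → o ≤ w → (I * g + (s + o) * q) % n ∈ hHatB n h B
  Sel⇒∈ {I} {s} sel o o≤ with select sel o o≤
  ... | S , S⊆ , len , idx , elt = subst (_∈ hHatB n h B) elt
    (∈-deduplicate⁺ _≟_ (∈-map⁺ (eltSum n) (subst (λ l → S ∈ choose l B) len (⊆-choose S⊆))))

  -- Columns count only modulo d, because d q = n.
  row-cong : ∀ I x y u v → x + u * d ≡ y + v * d → (I * g + x * q) % n ≡ (I * g + y * q) % n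
  row-cong I x y u v eq = %-≡⇐ n u v (begin
    I * g + x * q + u * n         ≡⟨ cong (λ z → I * g + x * q + u * z) n≡ ⟩
    I * g + x * q + u * (d * q)   ≡⟨ lem (I * g) x q u d ⟩
    I * g + (x + u * d) * q       ≡⟨ cong (λ z → I * g + z * q) eq ⟩
    I * g + (y + v * d) * q       ≡⟨ lem (I * g) y q v d ⟨
    I * g + y * q + v * (d * q)   ≡⟨ cong (λ z → I * g + y * q + v * z) n≡ ⟨
    I * g + y * q + v * n         ∎)
    where
    open ≡-Reasoning
    lem : ∀ i x q u d → i + x * q + u * (d * q) ≡ i + (x + u * d) * q
    lem = solve-∀

  Sel⇒Full : ∀ {I s w} → d ≤ suc w → Sel B h I s w → Full I
  Sel⇒Full {I} {s} {w} d≤ sel j =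
    subst (_∈ hHatB n h B) (row-cong I (s + o) j (x / d) s eq)
      (Sel⇒∈ sel o (s≤s⁻¹ (≤-trans (m%n<n x d) d≤)))
    where
    -- `pred d * s` stands for -s modulo d, so `o` below is the residue of j - s.
    x = j + pred d * s
    o = x % d
    eq : s + o + x / d * d ≡ j + s * d
    eq = begin
      s + o + x / d * d      ≡⟨ +-assoc s o _ ⟩
      s + (o + x / d * d)    ≡⟨ cong (s +_) (m≡m%n+[m/n]*n x d) ⟨
      s + (j + pred d * s)   ≡⟨ lem s j (pred d) ⟩
      j + s * suc (pred d)   ≡⟨ cong (λ z → j + s * z) (suc-pred d) ⟩
      j + s * d              ∎
      where
      open ≡-Reasoning
      lem : ∀ s j p → s + (j + p * s) ≡ j + s * suc p
      lem = solve-∀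

  Sel-B : ∀ {a b e} I s w z z′ → a + z ≡ k₁ → e + z′ ≡ k₂ → Sel (cosets d C) b I s w → a + (b + e) ≡ h →
    Sel B h (I + e * suc C) (tri a + (s + (e * j₀ + tri e))) (a * z + (w + e * z′))
  Sel-B {a} {b} {e} I s w z z′ p p′ sel refl =
    subst₂ (λ i s → Sel B (a + (b + e)) i s (a * z + (w + e * z′)))
      (cong (_+ (I + e * suc C)) (*-zeroʳ a))
      (cong (λ x → x + tri a + (s + (e * j₀ + tri e))) (*-zeroʳ a))
      (Sel-++ (Sel-block 0 0 a z p) (Sel-++ sel (Sel-block (suc C) j₀ e z′ p′)))

  Sel-bottom : h ≤ k₁ → Sel B h 0 (tri h) (h * (k₁ ∸ h))
  Sel-bottom h≤ = subst₂ (Sel B h 0) (+-identityʳ _) (+-identityʳ _)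
    (Sel-B 0 0 0 (k₁ ∸ h) k₂ (m+[n∸m]≡n h≤) refl (Sel-∅ _) (+-identityʳ h))

  Sel-top : h ≤ k₂ → Sel B h (h * suc C) (h * j₀ + tri h) (h * (k₂ ∸ h))
  Sel-top h≤ = Sel-B 0 0 0 k₁ (k₂ ∸ h) refl (m+[n∸m]≡n h≤) (Sel-∅ _) refl

  Sel-ends : ∀ a e → a + e ≡ h → a ≤ k₁ → e ≤ k₂ → ∃ λ s → Sel B h (e * suc C) s (a * (k₁ ∸ a) + e * (k₂ ∸ e))
  Sel-ends a e a+e a≤ e≤ = _ , Sel-B 0 0 0 (k₁ ∸ a) (k₂ ∸ e) (m+[n∸m]≡n a≤) (m+[n∸m]≡n e≤) (Sel-∅ _) a+e

  Sel-low : ∀ {C′} → C ≡ suc C′ → ∀ a b → a + b ≡ h → a ≤ k₁ → b ≤ d →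
    ∃ λ s → ∃ λ w → b * (d ∸ b) ≤ w × Sel B h b s w
  Sel-low {C′} refl a b a+b a≤ b≤ = _ , _ , ≤-trans (m≤m+n _ 0) (m≤n+m _ (a * (k₁ ∸ a)))
    , Sel-cast refl (+-identityʳ b)
       (Sel-B b _ _ (k₁ ∸ a) k₂ (m+[n∸m]≡n a≤) refl (proj₂ (Sel-first C′ b (d ∸ b) (m+[n∸m]≡n b≤)))
         (trans (cong (a +_) (+-identityʳ b)) a+b))

  Sel-high : ∀ {C′} → C ≡ suc C′ → ∀ b e → b + e ≡ h → e ≤ k₂ → b ≤ d →
    ∃ λ s → ∃ λ w → b * (d ∸ b) ≤ w × Sel B h (h * C + e) s w
  Sel-high {C′} refl b e b+e e≤ b≤ = _ , _ , m≤m+n _ _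
    , Sel-cast refl (trans (lem b e C′) (cong (λ z → z * suc C′ + e) b+e))
       (Sel-B (b * suc C′) _ _ k₁ (k₂ ∸ e) refl (m+[n∸m]≡n e≤) (proj₂ (Sel-last C′ b (d ∸ b) (m+[n∸m]≡n b≤))) b+e)
    where
    lem : ∀ b e C → b * suc C + e * suc (suc C) ≡ (b + e) * suc C + e
    lem = solve-∀

  All-B : ∀ {P : ℕ × ℕ → Set} → (∀ i x → i ≤ suc C → P ((i * g + x * q) % n , i)) → All P B
  All-B {P} p = All.++⁺ (All-block 0 0 k₁ z≤n)
    (All.++⁺ (All.concat⁺ (All.map⁺ (All.applyUpTo⁺₁ suc C λ {i} i<C → All-block (suc i) 0 d (s≤s (<⇒≤ i<C)))))
             (All-block (suc C) j₀ k₂ ≤-refl))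
    where
    All-block : ∀ i j k → i ≤ suc C → All P (block i j k)
    All-block i j k i≤ = All.map⁺ (All.universal (λ x → p i (j + x) i≤) (upTo k))

  -- The extreme index sums and the completeness of all rows between them.

  module Range (1≤h : 1 ≤ h) (h≤ : h ≤ k₁ ⊔ k₂) (k₁<d : k₁ < d) (k₂<d : k₂ < d) (d<k₁+k₂ : d < k₁ + k₂) where

    private
      h<d : h < d
      h<d = ≤-<-trans h≤ (⊔-lub-< k₁<d k₂<d)
        where
        ⊔-lub-< : ∀ {a b} → a < d → b < d → a ⊔ b < d
        ⊔-lub-< {a} {b} p r with ≤-total a b
        ... | inj₁ a≤b = subst (_< d) (sym (m≤n⇒m⊔n≡n a≤b)) r
        ... | inj₂ b≤a = subst (_< d) (sym (m≥n⇒m⊔n≡m b≤a)) p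

    h≤k₁⊎h≤k₂ : h ≤ k₁ ⊎ h ≤ k₂
    h≤k₁⊎h≤k₂ with ≤-total k₁ k₂
    ... | inj₁ p = inj₂ (subst (h ≤_) (m≤n⇒m⊔n≡n p) h≤)
    ... | inj₂ p = inj₁ (subst (h ≤_) (m≥n⇒m⊔n≡m p) h≤)

    d≤1+b[d-b] : ∀ {b w} → 1 ≤ b → b ≤ h → b * (d ∸ b) ≤ w → d ≤ suc w
    d≤1+b[d-b] 1≤b b≤h ≤w = ≤-trans (≤-reflexive (sym (m+[n∸m]≡n (<⇒≤ b<d))))
      (≤-trans (suc-*-≥ 1≤b (m<n⇒0<n∸m b<d)) (s≤s ≤w))
      where b<d = ≤-<-trans b≤h h<d

    Full-low : ∀ {C′} → C ≡ suc C′ → ∀ I → 1 ≤ I → I ≤ h → h ∸ I ≤ k₁ → Full I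
    Full-low C≡ I 1≤I I≤h h∸I≤ with Sel-low C≡ (h ∸ I) I (m∸n+n≡m I≤h) h∸I≤ (<⇒≤ (≤-<-trans I≤h h<d))
    ... | s , w , ≤w , sl = Sel⇒Full (d≤1+b[d-b] 1≤I I≤h ≤w) sl

    Full-high : ∀ {C′} → C ≡ suc C′ → ∀ e → e < h → e ≤ k₂ → Full (h * C + e)
    Full-high C≡ e e<h e≤ with Sel-high C≡ (h ∸ e) e (m∸n+n≡m (<⇒≤ e<h)) e≤ (<⇒≤ (≤-<-trans (m∸n≤m h e) h<d))
    ... | s , w , ≤w , sl = Sel⇒Full (d≤1+b[d-b] (m<n⇒0<n∸m e<h) (m∸n≤m h e) ≤w) sl

    -- Without a complete coset in B, the blocks B' and B'' must fill the row together. Each has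
    -- width at least its length minus 1, and k₁ + k₂ ≥ d + 1 is just enough to make up for the two
    -- lost units.
    Full-ends : C ≡ 0 → ∀ I → I < h → h ∸ I < k₁ → 1 ≤ I → I < k₂ → Full I
    Full-ends refl I I<h u<k₁ 1≤I I<k₂ with Sel-ends (h ∸ I) I (m∸n+n≡m (<⇒≤ I<h)) (<⇒≤ u<k₁) (<⇒≤ I<k₂)
    ... | s , sl = subst Full (*-identityʳ I) (Sel⇒Full d≤ sl)
      where
      u = h ∸ I
      d≤ : d ≤ suc (u * (k₁ ∸ u) + I * (k₂ ∸ I))
      d≤ = s≤s⁻¹ (begin
        suc d                                    ≤⟨ d<k₁+k₂ ⟩
        k₁ + k₂                                  ≡⟨ cong₂ _+_ (m+[n∸m]≡n (<⇒≤ u<k₁)) (m+[n∸m]≡n (<⇒≤ I<k₂)) ⟨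
        u + (k₁ ∸ u) + (I + (k₂ ∸ I))            ≤⟨ +-mono-≤ (suc-*-≥ (m<n⇒0<n∸m I<h) (m<n⇒0<n∸m u<k₁))
                                                               (suc-*-≥ 1≤I (m<n⇒0<n∸m I<k₂)) ⟩
        suc (u * (k₁ ∸ u)) + suc (I * (k₂ ∸ I))  ≡⟨ +-suc (suc (u * (k₁ ∸ u))) _ ⟩
        suc (suc (u * (k₁ ∸ u) + I * (k₂ ∸ I)))  ∎)
        where open ≤-Reasoning

    Full-cosets : ∀ {C′} → C ≡ suc C′ → ∀ I → h ≤ I → I ≤ h * C → Full I
    Full-cosets {C′} refl I h≤I I≤ with Sel-cosets C′ h I 1≤h h<d h≤I I≤
    ... | s , w , d≤ , sl = Sel⇒Full (≤-trans d≤ (s≤s (m≤m+n w 0)))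
        (Sel-cast refl (+-identityʳ I) (Sel-B I s w k₁ k₂ refl refl sl (+-identityʳ h)))

    -- For c ≥ 2, index sums up to h use B' and the first coset, those up to h C only complete
    -- cosets, and larger ones the last coset and B''. For c = 1 only B' and B'' are available.
    -- Strictness at both ends guarantees a block that is used only partially.
    Full-between : ∀ I → h ∸ k₁ < I → I < h * C + (h ⊓ k₂) → Full I
    Full-between I <I I< = go C refl
      where
      u<k₁ : I ≤ h → h ∸ I < k₁
      u<k₁ I≤h = +-cancelʳ-< I (h ∸ I) k₁ (subst (_< k₁ + I) (sym (m∸n+n≡m I≤h))
        (≤-<-trans (m≤n+m∸n h k₁) (+-monoʳ-< k₁ <I)))
      1≤I : 1 ≤ I
      1≤I = ≤-<-trans z≤n <I
      go : ∀ C′ → C ≡ C′ → Full I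
      go zero C≡ = Full-ends C≡ I I<h (u<k₁ (<⇒≤ I<h)) 1≤I (≤-trans I<′ (m⊓n≤n h k₂))
        where
        I<′ : I < h ⊓ k₂
        I<′ = subst (I <_) (cong (_+ (h ⊓ k₂)) (trans (cong (h *_) C≡) (*-zeroʳ h))) I<
        I<h = ≤-trans I<′ (m⊓n≤m h k₂)
      go (suc C′) C≡ with I ≤? h
      ... | yes I≤h = Full-low C≡ I 1≤I I≤h (<⇒≤ (u<k₁ I≤h))
      ... | no I≰h with I ≤? h * C
      ...   | yes I≤ = Full-cosets C≡ I (<⇒≤ (≰⇒> I≰h)) I≤
      ...   | no I≰ = subst Full e≡ (Full-high C≡ (I ∸ h * C) (≤-trans e< (m⊓n≤m h k₂)) (≤-trans (<⇒≤ e<) (m⊓n≤n h k₂)))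
        where
        e≡ : h * C + (I ∸ h * C) ≡ I
        e≡ = m+[n∸m]≡n (<⇒≤ (≰⇒> I≰))
        e< : I ∸ h * C < h ⊓ k₂
        e< = +-cancelˡ-< (h * C) _ _ (subst (_< h * C + (h ⊓ k₂)) (sym e≡) I<)

    private
      attained : ∀ {I s w} → Sel B h I s w → I ∈ map idxSum (hChoices h B)
      attained sl with select sl 0 z≤n
      ... | S , S⊆ , len , refl , _ = ∈-map⁺ idxSum (subst (λ l → S ∈ choose l B) len (⊆-choose S⊆))

      ∈-choices⁻ : ∀ {I} → I ∈ map idxSum (hChoices h B) → ∃ λ S → S ⊆ B × length S ≡ h × I ≡ idxSum S
      ∈-choices⁻ I∈ with ∈-map⁻ idxSum I∈
      ... | S , S∈ , refl with choose-⊆ S∈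
      ...   | S⊆ , len = S , S⊆ , len , refl

      sum-map-B : ∀ (φ : ℕ × ℕ → ℕ) a b →
        (∀ r → φ (r , 0) ≤ a) → (∀ i r → i < C → φ (r , suc i) ≤ 0) → (∀ r → φ (r , suc C) ≤ b) →
        sum (map φ B) ≤ k₁ * a + k₂ * b
      sum-map-B φ a b p p′ p″ = begin
        sum (map φ (X ++ Y ++ Z))                      ≡⟨ cong sum (trans (map-++ φ X (Y ++ Z)) (cong (map φ X ++_) (map-++ φ Y Z))) ⟩
        sum (map φ X ++ map φ Y ++ map φ Z)            ≡⟨ trans (sum-++ (map φ X) _) (cong (sum (map φ X) +_) (sum-++ (map φ Y) _)) ⟩
        sum (map φ X) + (sum (map φ Y) + sum (map φ Z)) ≤⟨ +-mono-≤ X≤ (+-mono-≤ Y≤ Z≤) ⟩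
        k₁ * a + (0 + k₂ * b)                          ∎
        where
        open ≤-Reasoning
        X = block 0 0 k₁
        Y = cosets d C
        Z = block (suc C) j₀ k₂
        len : ∀ i j k → length (block i j k) ≡ k
        len i j k = trans (length-map _ (upTo k)) (length-upTo k)
        X≤ : sum (map φ X) ≤ k₁ * a
        X≤ = subst (λ l → sum (map φ X) ≤ l * a) (len 0 0 k₁)
          (sum-All-≤ φ a (All.map⁺ (All.universal (λ _ → p _) (upTo k₁))))
        Y≤ : sum (map φ Y) ≤ 0
        Y≤ = subst (sum (map φ Y) ≤_) (*-zeroʳ (length Y))
          (sum-All-≤ φ 0 (All.concat⁺ (All.map⁺ (All.applyUpTo⁺₁ suc C λ {i} i<C → All.map⁺ (All.universal (λ _ → p′ i _ i<C) (upTo d))))))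
        Z≤ : sum (map φ Z) ≤ k₂ * b
        Z≤ = subst (λ l → sum (map φ Z) ≤ l * b) (len (suc C) j₀ k₂)
          (sum-All-≤ φ b (All.map⁺ (All.universal (λ _ → p″ _) (upTo k₂))))

      length≤ : ∀ (S : List (ℕ × ℕ)) → length S ≤ idxSum S + sum (map (λ p → 1 ∸ proj₂ p) S)
      length≤ [] = z≤n
      length≤ ((r , i) ∷ S) = ≤-trans (+-mono-≤ (m≤n+m∸n 1 i) (length≤ S)) (≤-reflexive (lem i (1 ∸ i) _ _))
        where
        lem : ∀ a b c d → a + b + (c + d) ≡ a + c + (b + d)
        lem = solve-∀

      idxSum≤ : ∀ (S : List (ℕ × ℕ)) → idxSum S ≤ length S * C + sum (map (λ p → proj₂ p ∸ C) S)
      idxSum≤ [] = z≤n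
      idxSum≤ ((r , i) ∷ S) = ≤-trans (+-mono-≤ (m≤n+m∸n i C) (idxSum≤ S)) (≤-reflexive (lem C (i ∸ C) _ _))
        where
        lem : ∀ a b c d → a + b + (c + d) ≡ a + c + (b + d)
        lem = solve-∀

    -- At most k₁ chosen elements have index 0, and these are what `1 ∸ i` counts. The minimum takes
    -- B' first and continues with index 1; for c = 1 that is B'', which has room because h > k₁
    -- implies h ≤ k₂.
    iMin≡ : iMin h B ≡ h ∸ k₁
    iMin≡ = ≤-antisym (listMin-≤ _ min∈) (listMin-glb _ min∈ lower)
      where
      lower : ∀ {I} → I ∈ map idxSum (hChoices h B) → h ∸ k₁ ≤ I
      lower I∈ with ∈-choices⁻ I∈
      ... | S , S⊆ , refl , refl = m≤n+o⇒m∸n≤o (length S) k₁ (begin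
        length S                                       ≤⟨ length≤ S ⟩
        idxSum S + sum (map (λ p → 1 ∸ proj₂ p) S)     ≤⟨ +-monoʳ-≤ (idxSum S) (≤-trans (sum-⊆ _ S⊆) sum≤) ⟩
        idxSum S + (k₁ * 1 + k₂ * 0)                   ≡⟨ lem (idxSum S) k₁ k₂ ⟩
        k₁ + idxSum S                                  ∎)
        where
        open ≤-Reasoning
        sum≤ = sum-map-B (λ p → 1 ∸ proj₂ p) 1 0 (λ _ → ≤-refl)
                 (λ i _ _ → ≤-reflexive (0∸n≡0 i)) (λ _ → ≤-reflexive (0∸n≡0 C))
        lem : ∀ x k k′ → x + (k * 1 + k′ * 0) ≡ k + x
        lem = solve-∀
      min∈ : h ∸ k₁ ∈ map idxSum (hChoices h B)
      min∈ with h ≤? k₁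
      ... | yes p = subst (_∈ map idxSum (hChoices h B)) (sym (m≤n⇒m∸n≡0 p)) (attained (Sel-bottom p))
      ... | no p = go C refl
        where
        k₁≤h = <⇒≤ (≰⇒> p)
        go : ∀ C′ → C ≡ C′ → h ∸ k₁ ∈ map idxSum (hChoices h B)
        go zero C≡ = subst (_∈ map idxSum (hChoices h B)) (trans (cong (λ z → (h ∸ k₁) * suc z) C≡) (*-identityʳ _))
          (attained (proj₂ (Sel-ends k₁ (h ∸ k₁) (m+[n∸m]≡n k₁≤h) ≤-refl
            (≤-trans (m∸n≤m h k₁) (fromInj₂ (λ r → contradiction r p) h≤k₁⊎h≤k₂)))))
        go (suc C′) C≡ with Sel-low C≡ k₁ (h ∸ k₁) (m+[n∸m]≡n k₁≤h) ≤-refl (≤-trans (m∸n≤m h k₁) (<⇒≤ h<d))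
        ... | _ , _ , _ , sl = attained sl

    -- An index is at most C plus an excess that is 1 on B'' and 0 elsewhere, so the total excess is
    -- capped both by h and by k₂.
    iMax≡ : iMax h B ≡ h * C + (h ⊓ k₂)
    iMax≡ = ≤-antisym (listMax-lub _ max∈ upper) (listMax-≥ _ max∈)
      where
      upper : ∀ {I} → I ∈ map idxSum (hChoices h B) → I ≤ h * C + (h ⊓ k₂)
      upper I∈ with ∈-choices⁻ I∈
      ... | S , S⊆ , refl , refl = ≤-trans (idxSum≤ S) (+-monoʳ-≤ (length S * C) (⊓-glb
          (≤-trans (sum-All-≤ ψ 1 (Sub.All-resp-⊆ S⊆ (All-B {λ p → ψ p ≤ 1} λ i _ i≤ →
                      ≤-trans (∸-monoˡ-≤ C i≤) (≤-reflexive (m+n∸n≡m 1 C)))))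
                   (≤-reflexive (*-identityʳ (length S))))
          (≤-trans (sum-⊆ ψ S⊆)
            (≤-trans (sum-map-B ψ 0 1 (λ _ → m∸n≤m 0 C) (λ i _ i<C → ≤-reflexive (m≤n⇒m∸n≡0 i<C)) (λ _ → ≤-reflexive (m+n∸n≡m 1 C)))
                     (≤-reflexive (lem k₁ k₂))))))
        where
        ψ : ℕ × ℕ → ℕ
        ψ p = proj₂ p ∸ C
        lem : ∀ k k′ → k * 0 + k′ * 1 ≡ k′
        lem = solve-∀
      max∈ : h * C + (h ⊓ k₂) ∈ map idxSum (hChoices h B)
      max∈ with h ≤? k₂
      ... | yes p = subst (_∈ map idxSum (hChoices h B))
              (trans (*-suc h C) (trans (+-comm h _) (cong (h * C +_) (sym (m≤n⇒m⊓n≡m p))))) (attained (Sel-top p))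
      ... | no p = subst (λ v → h * C + v ∈ map idxSum (hChoices h B)) (sym (m≥n⇒m⊓n≡n k₂≤h)) (go C refl)
        where
        k₂≤h = <⇒≤ (≰⇒> p)
        go : ∀ C′ → C ≡ C′ → h * C + k₂ ∈ map idxSum (hChoices h B)
        go zero C≡ = subst (_∈ map idxSum (hChoices h B))
          (trans (cong (λ z → k₂ * suc z) C≡) (trans (*-identityʳ k₂) (cong (_+ k₂) (sym (trans (cong (h *_) C≡) (*-zeroʳ h))))))
          (attained (proj₂ (Sel-ends (h ∸ k₂) k₂ (m∸n+n≡m k₂≤h)
            (≤-trans (m∸n≤m h k₂) (fromInj₁ (λ r → contradiction r p) h≤k₁⊎h≤k₂)) ≤-refl)))
        go (suc C′) C≡ with Sel-high C≡ (h ∸ k₂) k₂ (m∸n+n≡m k₂≤h) ≤-refl (≤-trans (m∸n≤m h k₂) (<⇒≤ h<d))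
        ... | _ , _ , _ , sl = attained sl

-- t is the order of g modulo the multiples of q.
order-mod : ∀ q g .{{_ : NonZero q}} → ∃ λ t → ∃ λ γ → q ≡ t * γ × γ ∣ g × (∀ x → q ∣ x * g → t ∣ x)
order-mod q g = q / γ , γ , sym (m/n*n≡m γ∣q) , γ∣g , λ x q∣ → coprime-divisor (coprime-/gcd q g)
    (*-cancelʳ-∣ γ (subst₂ _∣_ (sym (m/n*n≡m γ∣q)) (eq x) q∣))
  where
  γ = gcd q g
  instance
    γ≢0 : NonZero γ
    γ≢0 = ≢-nonZero (gcd[m,n]≢0 q g (inj₁ (≢-nonZero⁻¹ q)))
  γ∣q = gcd[m,n]∣m q g
  γ∣g = gcd[m,n]∣n q g
  eq : ∀ x → x * g ≡ g / γ * x * γ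
  eq x = trans (cong (x *_) (sym (m/n*n≡m γ∣g))) (lem x (g / γ) γ)
    where
    lem : ∀ x y z → x * (y * z) ≡ y * x * z
    lem = solve-∀

-- Counting residues by row and column.

module Counting (n : ℕ) .{{_ : NonZero n}} (q d : ℕ) .{{_ : NonZero q}} .{{_ : NonZero d}} (n≡ : n ≡ d * q) (g : ℕ)
  (t : ℕ) (t∣ : ∀ x → q ∣ x * g → t ∣ x) where

  -- Equal residues give q ∣ (b - a) g, so t divides b - a < t and the rows agree; the columns then
  -- agree modulo d.
  row-col-injective : ∀ N s a b i j → a ≤ b → b < t → i < d → j < d →
    ((N + a) * g + (s + i) * q) % n ≡ ((N + b) * g + (s + j) * q) % n → a ≡ b × i ≡ j
  row-col-injective N s a b i j a≤b b<t i<d j<d eq with %-≡⇒ n eq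
  ... | u , v , eq′ = a≡b , trans (sym (m<n⇒m%n≡m i<d)) (trans (%-≡⇐ d u v i≡j) (m<n⇒m%n≡m j<d))
    where
    e = b ∸ a
    cancelled : (s + i + u * d) * q ≡ e * g + (s + j + v * d) * q
    cancelled = +-cancelˡ-≡ ((N + a) * g) _ _ (begin
      (N + a) * g + (s + i + u * d) * q              ≡⟨ lem ((N + a) * g) (s + i) q u d ⟨
      (N + a) * g + (s + i) * q + u * (d * q)        ≡⟨ cong (λ z → (N + a) * g + (s + i) * q + u * z) n≡ ⟨
      (N + a) * g + (s + i) * q + u * n              ≡⟨ eq′ ⟩
      (N + b) * g + (s + j) * q + v * n              ≡⟨ cong₂ (λ y z → (N + y) * g + (s + j) * q + v * z) (sym (m+[n∸m]≡n a≤b)) n≡ ⟩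
      (N + (a + e)) * g + (s + j) * q + v * (d * q)  ≡⟨ lem₂ N a e g (s + j) q v d ⟩
      (N + a) * g + (e * g + (s + j + v * d) * q)    ∎)
      where
      open ≡-Reasoning
      lem : ∀ A x q u d → A + x * q + u * (d * q) ≡ A + (x + u * d) * q
      lem = solve-∀
      lem₂ : ∀ N a e g x q u d → (N + (a + e)) * g + x * q + u * (d * q) ≡ (N + a) * g + (e * g + (x + u * d) * q)
      lem₂ = solve-∀
    t∣e : t ∣ e
    t∣e = t∣ e (∣m+n∣m⇒∣n (subst (q ∣_) (trans cancelled (+-comm (e * g) _)) (n∣m*n (s + i + u * d))) (n∣m*n (s + j + v * d)))
    e≡0 : e ≡ 0
    e≡0 with e ≟ 0
    ... | yes p = p
    ... | no p = contradiction (∣⇒≤ {{≢-nonZero p}} t∣e) (<⇒≱ (≤-<-trans (m∸n≤m b a) b<t))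
    a≡b : a ≡ b
    a≡b = ≤-antisym a≤b (m∸n≡0⇒m≤n e≡0)
    i≡j : i + u * d ≡ j + v * d
    i≡j = +-cancelˡ-≡ s _ _ (trans (sym (+-assoc s i _)) (trans (*-cancelʳ-≡ _ _ q
      (trans cancelled (cong (λ z → z * g + (s + j + v * d) * q) e≡0))) (+-assoc s j _)))

  -- Quotient and remainder modulo d number the cells of the t by d grid row by row, starting from
  -- row N and column s.
  length-≥ : ∀ (N s M : ℕ) (xs : List ℕ) → M ≤ t * d →
    (∀ x → x < M → ((N + x / d) * g + (s + x % d) * q) % n ∈ xs) → M ≤ length xs
  length-≥ N s M xs M≤ f∈ = subst (_≤ length xs) (trans (length-map f (upTo M)) (length-upTo M))
      (unique-⊆-length (subst Unique (sym (map-upTo f M)) (Unique.applyUpTo⁺₁ f M λ {i} {j} i<j j<M eq →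
          <⇒≢ i<j (f-injective (<⇒≤ i<j) (≤-trans j<M M≤) eq))) sub)
    where
    f : ℕ → ℕ
    f x = ((N + x / d) * g + (s + x % d) * q) % n
    f-injective : ∀ {x y} → x ≤ y → y < t * d → f x ≡ f y → x ≡ y
    f-injective {x} {y} x≤y y< eq
      with row-col-injective N s (x / d) (y / d) (x % d) (y % d) (/-monoˡ-≤ d x≤y) (m<n*o⇒m/o<n y<) (m%n<n x d) (m%n<n y d) eq
    ... | p , r = trans (m≡m%n+[m/n]*n x d) (trans (cong₂ (λ y z → y + z * d) r p) (sym (m≡m%n+[m/n]*n y d)))
    sub : ∀ {z} → z ∈ map f (upTo M) → z ∈ xs
    sub z∈ with ∈-map⁻ f z∈
    ... | x , x∈ , refl = f∈ x (∈-upTo⁻ x∈)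

  module Sumset (j₀ C k₁ k₂ h : ℕ) where

    open Selections n q g
    open IndexedSums n q d n≡ g j₀ C k₁ k₂ h

    private
      L = length (hHatB n h B)

    -- B lies among the multiples of γ, a subgroup of order t d because n = t d γ.
    cardB-≤ : ∀ γ → q ≡ t * γ → γ ∣ g → cardB B ≤ t * d
    cardB-≤ γ q≡ γ∣g = ≤-trans (unique-⊆-length (deduplicate-! (map proj₁ B)) sub)
        (≤-reflexive (trans (length-map (_* γ) (upTo (t * d))) (length-upTo (t * d))))
      where
      γ∣q : γ ∣ q
      γ∣q = divides t q≡
      n≡tdγ : n ≡ t * d * γ
      n≡tdγ = trans n≡ (trans (cong (d *_) q≡) (lem d t γ))
        where
        lem : ∀ d t γ → d * (t * γ) ≡ t * d * γ
        lem = solve-∀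
      multiples : All (λ p → γ ∣ proj₁ p × proj₁ p < n) B
      multiples = All-B λ i x _ → %-presˡ-∣ (∣m∣n⇒∣m+n (∣n⇒∣m*n i γ∣g) (∣n⇒∣m*n x γ∣q)) (divides (t * d) n≡tdγ)
                  , m%n<n (i * g + x * q) n
      sub : ∀ {z} → z ∈ deduplicate _≟_ (map proj₁ B) → z ∈ map (_* γ) (upTo (t * d))
      sub z∈ with ∈-map⁻ proj₁ (∈-deduplicate⁻ _≟_ (map proj₁ B) z∈)
      ... | p , p∈ , refl with All.lookup multiples p∈
      ...   | divides k eq , lt = subst (_∈ map (_* γ) (upTo (t * d))) (sym eq)
              (∈-map⁺ (_* γ) (∈-upTo⁺ (*-cancelʳ-< γ k (t * d) (subst₂ _<_ eq n≡tdγ lt))))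

    module _ (N₀ N₁ T : ℕ) (N₁≡ : N₀ + suc T ≡ N₁) (g-eq : (N₁ * g) % n ≡ (N₀ * g + q) % n) where

      -- Modulo n, (N₁ - N₀) g is q, so q divides it up to multiples of n, which are multiples of q
      -- themselves.
      t∣suc[T] : t ∣ suc T
      t∣suc[T] with %-≡⇒ n g-eq
      ... | u , v , eq = t∣ (suc T) (∣m+n∣m⇒∣n {n = suc T * g}
          (subst (q ∣_) (sym cancelled) (∣m∣n⇒∣m+n ∣-refl (∣n⇒∣m*n v q∣n))) (∣n⇒∣m*n u q∣n))
        where
        q∣n : q ∣ n
        q∣n = divides d n≡
        cancelled : u * n + suc T * g ≡ q + v * n
        cancelled = +-cancelˡ-≡ (N₀ * g) _ _ (begin
          N₀ * g + (u * n + suc T * g)  ≡⟨ lem N₀ g (u * n) (suc T) ⟩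
          (N₀ + suc T) * g + u * n      ≡⟨ cong (λ z → z * g + u * n) N₁≡ ⟩
          N₁ * g + u * n                ≡⟨ eq ⟩
          N₀ * g + q + v * n            ≡⟨ +-assoc (N₀ * g) q _ ⟩
          N₀ * g + (q + v * n)          ∎)
          where
          open ≡-Reasoning
          lem : ∀ N g x T → N * g + (x + T * g) ≡ (N + T) * g + x
          lem = solve-∀

      row-shift : ∀ y → (N₁ * g + y * q) % n ≡ (N₀ * g + suc y * q) % n
      row-shift y = trans (+-cong-% n g-eq refl) (cong (_% n) (+-assoc (N₀ * g) q (y * q)))

      module _ (between : ∀ I → N₀ < I → I < N₁ → Full I) where

        length-≥-rows : t < suc T → t * d ≤ L
        length-≥-rows t<T = length-≥ (suc N₀) 0 (t * d) (hHatB n h B) ≤-refl λ x x< →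
          between (suc N₀ + x / d) (s≤s (m≤m+n N₀ _))
            (subst (suc N₀ + x / d <_) N₁≡ (subst (_< N₀ + suc T) (+-suc N₀ _) (+-monoʳ-< N₀
              (<-≤-trans (s≤s (m<n*o⇒m/o<n x<)) t<T)))) (x % d)

        -- A complete row can be read from any column, so all rows are read from the column where
        -- the segment in row N₁ begins; that segment comes last.
        length-≥-top : t ≡ suc T → ∀ s w → w < d → (∀ r → r ≤ w → (N₁ * g + (s + r) * q) % n ∈ hHatB n h B) → T * d + suc w ≤ L
        length-≥-top t≡ s w w<d top = length-≥ (suc N₀) s (T * d + suc w) (hHatB n h B) M≤ rows
          where
          M≤ : T * d + suc w ≤ t * d
          M≤ = ≤-trans (+-monoʳ-≤ (T * d) w<d) (≤-reflexive (trans (+-comm (T * d) d) (cong (_* d) (sym t≡))))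
          rows : ∀ x → x < T * d + suc w → ((suc N₀ + x / d) * g + (s + x % d) * q) % n ∈ hHatB n h B
          rows x x< with x / d <? T
          ... | yes p = between (suc N₀ + x / d) (s≤s (m≤m+n N₀ _))
                (subst (suc N₀ + x / d <_) N₁≡ (subst (_< N₀ + suc T) (+-suc N₀ _) (+-monoʳ-< N₀ (s≤s p)))) (s + x % d)
          ... | no p = subst (λ z → (z * g + (s + x % d) * q) % n ∈ hHatB n h B) (sym (trans (cong (suc N₀ +_) x/d≡T) (trans (sym (+-suc N₀ T)) N₁≡)))
                (top (x % d) (s≤s⁻¹ (+-cancelˡ-< (T * d) _ _ (subst (_< T * d + suc w) x≡ x<))))
            where
            x/d≡T : x / d ≡ T
            x/d≡T = ≤-antisym (s≤s⁻¹ (m<n*o⇒m/o<n (<-≤-trans x< (≤-trans M≤ (≤-reflexive (cong (_* d) t≡)))))) (≮⇒≥ p)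
            x≡ : x ≡ T * d + x % d
            x≡ = trans (m≡m%n+[m/n]*n x d) (trans (+-comm (x % d) _) (cong (λ z → z * d + x % d) x/d≡T))

        length-≥-max : t ≡ suc T → ∀ {s w} v → Sel B h N₁ s w → v ≤ w → v < d → T * d + suc v ≤ L
        length-≥-max t≡ {s} v sl v≤w v<d = length-≥-top t≡ s v v<d λ r r≤ → Sel⇒∈ sl r (≤-trans r≤ v≤w)

        -- Column s of row N₀ is column s - 1 of row N₁; modulo d the latter is written
        -- `s + pred d`.
        length-≥-min : t ≡ suc T → ∀ {s w} v → Sel B h N₀ s w → v ≤ w → v < d → T * d + suc v ≤ L
        length-≥-min t≡ {s} v sl v≤w v<d = length-≥-top t≡ (s + pred d) v v<d λ r r≤ →
          subst (_∈ hHatB n h B) (trans (row-cong N₀ (s + r) (suc (s + pred d + r)) 1 0 (eq r)) (sym (row-shift (s + pred d + r))))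
            (Sel⇒∈ sl r (≤-trans r≤ v≤w))
          where
          eq : ∀ r → s + r + 1 * d ≡ suc (s + pred d + r) + 0 * d
          eq r = trans (cong (λ z → s + r + 1 * z) (sym (suc-pred d))) (lem s r (pred d))
            where
            lem : ∀ s r p → s + r + 1 * suc p ≡ suc (s + p + r) + 0
            lem = solve-∀

        -- Both end rows miss a single residue; when h and d are even they
        -- are shifted against each other by the odd number 1 + h j₀.
        length-≥-even : t ≡ suc T → ∀ {w} → d ≡ 2 + w → 2 ∣ h → 2 ∣ d →
          Sel B h N₁ (h * j₀ + tri h) w → Sel B h N₀ (tri h) w → suc T * d ≤ L
        length-≥-even t≡ {w} d≡ 2∣h 2∣d top bottom =
          ≤-trans (≤-reflexive (trans (+-comm d (T * d)) (cong (T * d +_) d≡))) (length-≥-top t≡ s (suc w) (≤-reflexive (sym d≡)) rows)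
          where
          s = h * j₀ + tri h
          o = (h * j₀) % d
          -- This could fail only for o = d - 1, which is odd, whereas an even number reduced modulo
          -- an even d stays even.
          o≤w : o ≤ w
          o≤w with o ≤? w
          ... | yes p = p
          ... | no p = contradiction (∣⇒≤ (2∣1 (subst (2 ∣_) (trans d≡ (cong suc (sym o≡))) 2∣d)
                                              (%-presˡ-∣ (∣m⇒∣m*n j₀ 2∣h) 2∣d))) λ { (s≤s ()) }
            where
            o≡ : o ≡ suc w
            o≡ = ≤-antisym (s≤s⁻¹ (subst (o <_) d≡ (m%n<n (h * j₀) d))) (≰⇒> p)
            2∣1 : 2 ∣ 1 + o → 2 ∣ o → 2 ∣ 1
            2∣1 x y = ∣m+n∣m⇒∣n (subst (2 ∣_) (+-comm 1 o) x) y
          rows : ∀ r → r ≤ suc w → (N₁ * g + (s + r) * q) % n ∈ hHatB n h B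
          rows r r≤ with r ≤? w
          ... | yes p = Sel⇒∈ top r p
          -- The single column missing from the top interval is s + w + 1. In row N₀ it is s + w +
          -- 2, which is `tri h + o` modulo d.
          ... | no p with ≤-antisym r≤ (≰⇒> p)
          ...   | refl = subst (_∈ hHatB n h B) (trans (row-cong N₀ (tri h + o) (suc (s + suc w)) (suc (h * j₀ / d)) 0 eq)
                                                        (sym (row-shift (s + suc w)))) (Sel⇒∈ bottom o o≤w)
            where
            eq : tri h + o + suc (h * j₀ / d) * d ≡ suc (s + suc w) + 0
            eq = begin
              tri h + o + (d + h * j₀ / d * d)   ≡⟨ lem (tri h) o d (h * j₀ / d * d) ⟩
              tri h + (o + h * j₀ / d * d) + d   ≡⟨ cong₂ (λ y z → tri h + y + z) (sym (m≡m%n+[m/n]*n (h * j₀) d)) d≡ ⟩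
              tri h + h * j₀ + (2 + w)           ≡⟨ lem₂ (tri h) (h * j₀) w ⟩
              suc (s + suc w) + 0                ∎
              where
              open ≡-Reasoning
              lem : ∀ a b c e → a + b + (c + e) ≡ a + (b + e) + c
              lem = solve-∀
              lem₂ : ∀ a b w → a + b + (2 + w) ≡ suc (b + a + suc w) + 0
              lem₂ = solve-∀

-- Comparison of the counts with the bounds for u^.

Exceptional : ℕ → ℕ → ℕ → Set
Exceptional n m h =
  (h ≡ 2 × ¬ (∃ λ t → m ∸ 1 ≡ 2 ^ t) × (2 * m ∸ 2) ∣ n)
  ⊎ (h ≡ 3 × m ≡ 6 × 10 ∣ n)
  ⊎ (¬ (2 ∣ h) × (h + 2) ∣ (m + 2) × (h * m ∸ h * h) ∣ n)

Bound : ℕ → ℕ → ℕ → ℕ → ℕ → Set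
Bound n m h u L = (u ≤ L + 1) × (L + 1 ≡ u → Exceptional n m h)

strict : ∀ {n m h u L} → u ≤ L → Bound n m h u L
strict {L = L} u≤L = ≤-trans u≤L (m≤m+n L 1) , λ eq → contradiction (subst (_≤ L) (trans (sym eq) (+-comm L 1)) u≤L) (<⇒≱ ≤-refl)

exceptional : ∀ {n m h u L} → u ≤ suc L → Exceptional n m h → Bound n m h u L
exceptional {L = L} u≤ e = ≤-trans u≤ (≤-reflexive (+-comm 1 L)) , λ _ → e

odd∤2^ : ∀ a t → ¬ (3 + 2 * a ∣ 2 ^ t)
odd∤2^ a zero p = contradiction (∣⇒≤ p) λ { (s≤s ()) }
odd∤2^ a (suc t) (divides k eq) with euclidsLemma k (3 + 2 * a) prime[2] (divides (2 ^ t) (trans (sym eq) (*-comm 2 (2 ^ t))))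
... | inj₁ (divides j refl) = odd∤2^ a t (divides j (*-cancelˡ-≡ _ _ 2 (trans eq (lem j (3 + 2 * a)))))
  where
  lem : ∀ j x → j * 2 * x ≡ 2 * (j * x)
  lem = solve-∀
... | inj₂ 2∣ = contradiction (∣⇒≤ (∣m+n∣m⇒∣n {n = 1} (subst (2 ∣_) (lem a) 2∣) (m∣m*n (1 + a)))) λ { (s≤s ()) }
  where
  lem : ∀ a → 3 + 2 * a ≡ 2 * (1 + a) + 1
  lem = solve-∀

-- u stands for u^(n,m,h) and L for |h^B|.
-- The case c = 1 and km < h ≤ kM for the two end lengths km = 2 + p and
-- kM = h + z; further h = km + 1 + y and d = kM + 1 + f.
record LongSums (n m p y z f u L : ℕ) : Set where
  h = 3 + p + y
  d = 4 + p + y + z + f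
  field
    m≡   : m ≡ h + (2 + p + z)
    u≤Td : u ≤ (2 + p) * d
    u≤   : u ≤ suc (h * (2 + p + z))
    Td∣n : (2 + p) * d ∣ n
    L≥₁  : ∀ v → v ≤ h * z → v < d → (1 + p) * d + suc v ≤ L
    L≥₂  : ∀ v → v ≤ suc y * (z + (2 + p)) → v < d → (1 + p) * d + suc v ≤ L

  -- Here `2 + p + z` is m - h and `1 + p` is T. The slacks a and b replace a difference: L falls
  -- short of 1 + h (m - h) by at most b - a.
  near-interval : ∀ {v a b} k → (1 + p) * d + suc v ≤ L → h * (2 + p + z) + a ≡ (1 + p) * d + v + b → b ≤ k + a → u ≤ k + L
  near-interval {v} {a} {b} k v≤L eq b≤ = +-cancelʳ-≤ a u (k + L) (begin
    u + a                          ≤⟨ +-monoˡ-≤ a u≤ ⟩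
    suc (h * (2 + p + z) + a)      ≡⟨ cong suc eq ⟩
    suc ((1 + p) * d + v + b)      ≡⟨ cong (_+ b) (+-suc ((1 + p) * d) v) ⟨
    (1 + p) * d + suc v + b        ≤⟨ +-mono-≤ v≤L b≤ ⟩
    L + (k + a)                    ≡⟨ lem L k a ⟩
    k + L + a                      ∎)
    where
    open ≤-Reasoning
    lem : ∀ L k a → L + (k + a) ≡ k + L + a
    lem = solve-∀

  all-rows : (1 + p) * d + d ≤ L → Bound n m h u L
  all-rows le = strict (≤-trans u≤Td (≤-trans (≤-reflexive (+-comm d _)) le))

-- Against the interval bound, `L≥₂` has deficit z - (p + (1 + p)(y + f)) and `L≥₁` has deficit 2 +
-- y - (1 + p)(z + f). The first is harmless for z ≤ y. If z > y and the second is positive, then p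
-- = f = 0 and z = y + 1; an incomplete end row then forces y = 0.
bound-long-sums : ∀ {n m p y z f u L} (S : LongSums n m p y z f u L) → Bound n m (LongSums.h S) u L
bound-long-sums {p = p} {y} {z} {f} S with suc (LongSums.h S * z) <? LongSums.d S
... | no full = LongSums.all-rows S (LongSums.L≥₁ S (3 + p + y + z + f) (s≤s⁻¹ (≮⇒≥ full)) ≤-refl)
... | yes lt₁ with suc (suc y * (z + (2 + p))) <? LongSums.d S
...   | no full = LongSums.all-rows S (LongSums.L≥₂ S (3 + p + y + z + f) (s≤s⁻¹ (≮⇒≥ full)) ≤-refl)
...   | yes lt₂ with z ≤? y
...     | yes z≤y = strict (near-interval 0 (L≥₂ _ ≤-refl (<⇒≤ lt₂)) (lem p y z f)
            (≤-trans z≤y (≤-trans (m≤m+n y _) (≤-reflexive (lem₂ p y f)))))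
  where
  open LongSums S
  lem : ∀ p y z f → (3 + p + y) * (2 + p + z) + (p + (1 + p) * (y + f)) ≡ (1 + p) * (4 + p + y + z + f) + suc y * (z + (2 + p)) + z
  lem = solve-∀
  lem₂ : ∀ p y f → y + (f + p + p * (y + f)) ≡ p + (1 + p) * (y + f)
  lem₂ = solve-∀
...     | no z≰y with 2 + y ≤? (1 + p) * (z + f)
...       | yes le = strict (LongSums.near-interval S 0 (LongSums.L≥₁ S _ ≤-refl (<⇒≤ lt₁)) (lem p y z f) le)
  where
  lem : ∀ p y z f → (3 + p + y) * (2 + p + z) + (1 + p) * (z + f) ≡ (1 + p) * (4 + p + y + z + f) + (3 + p + y) * z + (2 + y)
  lem = solve-∀
bound-long-sums {n} {m} {p = p} {y} {z} {f} S | yes lt₁ | yes lt₂ | no z≰y | no gap = extremal p f y z p≡0 f≡0 y<z z≤ S lt₁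
  where
  y<z = ≰⇒> z≰y
  le : (z + f) + p * (z + f) ≤ suc y
  le = s≤s⁻¹ (≰⇒> gap)
  f+≤0 : f + p * (z + f) ≤ 0
  f+≤0 = +-cancelˡ-≤ z _ 0 (≤-trans (≤-reflexive (sym (+-assoc z f _))) (≤-trans le (≤-trans y<z (≤-reflexive (sym (+-identityʳ z))))))
  f≡0 : f ≡ 0
  f≡0 = m+n≡0⇒m≡0 f (n≤0⇒n≡0 f+≤0)
  p≡0 : p ≡ 0
  p≡0 with m*n≡0⇒m≡0∨n≡0 p (m+n≡0⇒n≡0 f (n≤0⇒n≡0 f+≤0))
  ... | inj₁ e = e
  ... | inj₂ e = contradiction (m+n≡0⇒m≡0 z e) (>⇒≢ (≤-<-trans z≤n y<z))
  z≤ : z ≤ suc y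
  z≤ = ≤-trans (m≤m+n z f) (≤-trans (m≤m+n (z + f) (p * (z + f))) le)
  extremal : ∀ p f y z → p ≡ 0 → f ≡ 0 → y < z → z ≤ suc y → ∀ {u L} (S : LongSums n m p y z f u L) →
    suc (LongSums.h S * z) < LongSums.d S → Bound n m (LongSums.h S) u L
  extremal zero zero y z refl refl y<z z≤ S lt with ≤-antisym z≤ y<z
  -- End lengths 2 and 4 with h = 3 and d = 5. The numbers 3, 1, 2 are the width h z and the two
  -- slacks: 9 + 1 = 5 + 3 + 2.
  extremal zero zero zero .1 refl refl y<z z≤ S lt | refl =
    exceptional (LongSums.near-interval S {3} {1} {2} 1 (LongSums.L≥₁ S 3 ≤-refl (s≤s (s≤s (s≤s (s≤s z≤n))))) refl ≤-refl)
      (inj₂ (inj₁ (refl , LongSums.m≡ S , LongSums.Td∣n S)))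
  extremal zero zero (suc y) .(2 + y) refl refl y<z z≤ S lt | refl =
    contradiction lt (≤⇒≯ (≤-trans (m≤m+n (4 + suc y + (2 + y) + 0) (2 + 4 * y + y * y)) (≤-reflexive (lem y))))
    where
    lem : ∀ y → 4 + suc y + (2 + y) + 0 + (2 + 4 * y + y * y) ≡ suc ((3 + suc y) * (2 + y))
    lem = solve-∀

-- The case h ≤ km ≤ kM for the two end lengths km = h + x and kM = h + x + r;
-- further d = kM + 1 + a, and T + 1 = i_max - i_min.
record ShortSums (n m h′ C x r a T u L : ℕ) : Set where
  h = 2 + h′
  d = 3 + h′ + x + r + a
  z = C * d + x + (h + x + r)
  w = h * (x + r)

  field
    m≡   : m ≡ h + z
    T≡   : suc T ≡ h * suc C
    sub  : ∀ e → e ∣ n → m ≤ e → u ≤ e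
    u≤   : u ≤ suc (h * z)
    Td∣n : suc T * d ∣ n
    m≤   : m ≤ suc T * d
    L≥   : ∀ v → v ≤ w → v < d → T * d + suc v ≤ L
    even : r ≡ 0 → d ≡ 2 + w → 2 ∣ h → 2 ∣ d → suc T * d ≤ L

  u≤Td : u ≤ suc T * d
  u≤Td = sub _ Td∣n m≤

  -- By `key`, 1 + h (m - h) exceeds T d + w + 1 by x + 1 - (h - 1)(a + r), where (T + 1) d = h c d.
  near-interval : ∀ k → suc w < d → suc x ≤ k + (1 + h′) * (a + r) → u ≤ k + L
  near-interval k w<d p = +-cancelʳ-≤ (d + X) u (k + L) (begin
    u + (d + X)                   ≤⟨ +-monoˡ-≤ (d + X) u≤ ⟩
    suc (h * z) + (d + X)         ≡⟨ cong suc (key h′ C x r a) ⟩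
    suc (h * suc C * d + w + suc x) ≡⟨ cong (λ y → suc (y * d + w + suc x)) (sym T≡) ⟩
    suc (suc T * d + w + suc x)   ≡⟨ lem d (T * d) w (suc x) ⟩
    (T * d + suc w) + d + suc x   ≤⟨ +-mono-≤ (+-monoˡ-≤ d (L≥ w ≤-refl (<⇒≤ w<d))) p ⟩
    L + d + (k + X)               ≡⟨ lem₂ L d k X ⟩
    k + L + (d + X)               ∎)
    where
    open ≤-Reasoning
    X = (1 + h′) * (a + r)
    key : ∀ h′ C x r a →
      (2 + h′) * (C * (3 + h′ + x + r + a) + x + ((2 + h′) + x + r)) + ((3 + h′ + x + r + a) + (1 + h′) * (a + r))
      ≡ (2 + h′) * suc C * (3 + h′ + x + r + a) + (2 + h′) * (x + r) + suc x
    key = solve-∀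
    lem : ∀ d t w y → suc (d + t + w + y) ≡ (t + suc w) + d + y
    lem = solve-∀
    lem₂ : ∀ L d k X → L + d + (k + X) ≡ k + L + (d + X)
    lem₂ = solve-∀

module _ where

  open ShortSums

  -- The parameters left over: the first inequality says that `near-interval` with k = 0 does not
  -- apply, the second is 1 + w < d after cancelling 2 + x + r.
  Critical : ℕ → ℕ → ℕ → ℕ → Set
  Critical h′ x r a = (1 + h′) * (a + r) ≤ x × (1 + h′) * (x + r) ≤ 1 + h′ + a

  -- Put H = h - 1. Inserting H times the first inequality into the second gives H² (a + r) ≤ H + (a
  -- + r). For H ≥ 2 this forces a = r = 0, and then H x ≤ H. For H = 1 the inequalities give 2 r ≤
  -- 1 and a ≤ x ≤ a + 1.
  critical-cases : ∀ h′ x r a → Critical h′ x r a →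
    r ≡ 0 × ((h′ ≡ 0 × (x ≡ a ⊎ x ≡ suc a)) ⊎ (∃ λ h″ → h′ ≡ suc h″ × a ≡ 0 × (x ≡ 0 ⊎ x ≡ 1)))
  critical-cases zero x r a (p , q) = r≡0 r 2r≤1 , inj₁ (refl , x-cases (≤⇒≤′ a≤x) (≤-trans (m≤m+n x r) x+r≤))
    where
    a+r≤x : a + r ≤ x
    a+r≤x = ≤-trans (≤-reflexive (sym (*-identityˡ _))) p
    a≤x = ≤-trans (m≤m+n a r) a+r≤x
    x+r≤ : x + r ≤ suc a
    x+r≤ = ≤-trans (≤-reflexive (sym (*-identityˡ _))) q
    2r≤1 : r + r ≤ 1
    2r≤1 = +-cancelˡ-≤ a (r + r) 1
      (≤-trans (≤-reflexive (sym (+-assoc a r r))) (≤-trans (+-monoˡ-≤ r a+r≤x) (≤-trans x+r≤ (≤-reflexive (+-comm 1 a)))))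
    r≡0 : ∀ r → r + r ≤ 1 → r ≡ 0
    r≡0 zero _ = refl
    r≡0 (suc r) le = contradiction (≤-trans (≤-reflexive (sym (+-suc r r))) (s≤s⁻¹ le)) λ ()
    x-cases : ∀ {x} → a ≤′ x → x ≤ suc a → x ≡ a ⊎ x ≡ suc a
    x-cases (≤′-reflexive refl) _ = inj₁ refl
    x-cases (≤′-step l) x≤ = inj₂ (≤-antisym x≤ (s≤s (≤′⇒≤ l)))
  critical-cases (suc h″) x r a (p , q) = m+n≡0⇒n≡0 a a+r≡0 , inj₂ (h″ , refl , a≡0 , x-cases x x≤1)
    where
    H = 2 + h″
    HH≤ : H * (H * (a + r)) ≤ H + (a + r)
    HH≤ = ≤-trans (*-monoʳ-≤ H (≤-trans p (m≤m+n x r))) (≤-trans q (+-monoʳ-≤ H (m≤m+n a r)))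
    a+r≡0 : a + r ≡ 0
    a+r≡0 = go (a + r) HH≤
      where
      go : ∀ y → H * (H * y) ≤ H + y → y ≡ 0
      go zero _ = refl
      go (suc y) le = contradiction (≤-trans (≤-reflexive (lem h″ y)) le)
          (<⇒≱ (m<m+n (H + suc y) (s≤s z≤n)))
        where
        lem : ∀ h y → (2 + h) + suc y + suc (3 * y + 3 * h + 4 * h * y + h * h * suc y) ≡ (2 + h) * ((2 + h) * suc y)
        lem = solve-∀
    a≡0 : a ≡ 0
    a≡0 = m+n≡0⇒m≡0 a a+r≡0
    x≤1 : x ≤ 1
    x≤1 = *-cancelˡ-≤ H (≤-trans (*-monoʳ-≤ H (m≤m+n x r))
      (≤-trans q (≤-reflexive (trans (cong (H +_) a≡0) (trans (+-identityʳ H) (sym (*-identityʳ H)))))))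
    x-cases : ∀ x → x ≤ 1 → x ≡ 0 ⊎ x ≡ 1
    x-cases zero _ = inj₁ refl
    x-cases (suc zero) _ = inj₂ refl
    x-cases (suc (suc _)) (s≤s ())

  bound-critical : ∀ {n m h′ C x r a T u L} (S : ShortSums n m h′ C x r a T u L) → suc (w S) < d S → Critical h′ x r a → Bound n m (h S) u L
  bound-critical {h′ = h′} {x = x} {r = r} {a = a} S w<d long with critical-cases h′ x r a long
  -- Now d = 3 + 2 a is odd, m - 1 = c d and (T + 1) d = 2 m - 2: exception (i).
  bound-critical {n} {m} {C = C} {a = a} {T = T} S w<d long | refl , inj₁ (refl , inj₁ refl) =
    exceptional (near-interval S 1 w<d (s≤s (≤-reflexive (lem a))))
      (inj₁ (refl , not-power , subst (_∣ n) eq (Td∣n S)))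
    where
    lem : ∀ a → a ≡ 1 * (a + 0)
    lem = solve-∀
    m≡′ : m ≡ suc (suc C * (3 + 2 * a))
    m≡′ = trans (m≡ S) (lem₂ C a)
      where
      lem₂ : ∀ C a → 2 + (C * (3 + a + 0 + a) + a + (2 + a + 0)) ≡ suc (suc C * (3 + 2 * a))
      lem₂ = solve-∀
    not-power : ¬ (∃ λ t → m ∸ 1 ≡ 2 ^ t)
    not-power (t , e) = odd∤2^ a t (subst (3 + 2 * a ∣_) (trans (cong (_∸ 1) (sym m≡′)) e) (n∣m*n (suc C)))
    eq : suc T * (3 + a + 0 + a) ≡ 2 * m ∸ 2
    eq = trans (cong (_* (3 + a + 0 + a)) (T≡ S)) (trans (lem₂ C a) (trans (sym (m+n∸m≡n 2 _))
      (cong (_∸ 2) (trans (lem₃ (suc C * (3 + 2 * a))) (cong (2 *_) (sym m≡′))))))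
      where
      lem₂ : ∀ C a → 2 * suc C * (3 + a + 0 + a) ≡ 2 * (suc C * (3 + 2 * a))
      lem₂ = solve-∀
      lem₃ : ∀ y → 2 + 2 * y ≡ 2 * suc y
      lem₃ = solve-∀
  -- Here d = 4 + 2 a and w = d - 2, so each end interval misses one column and the parity argument
  -- applies.
  bound-critical {a = a} S w<d long | refl , inj₁ (refl , inj₂ refl) =
    strict (≤-trans (u≤Td S) (even S refl (lem a) (divides 1 refl) (divides (2 + a) (lem₂ a))))
    where
    lem : ∀ a → 3 + suc a + 0 + a ≡ 2 + 2 * (suc a + 0)
    lem = solve-∀
    lem₂ : ∀ a → 3 + suc a + 0 + a ≡ (2 + a) * 2
    lem₂ = solve-∀
  -- End lengths h and d = h + 1: each end interval is a single sum, so the bound (T + 1) d is too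
  -- weak. The subgroup of half that order still has at least m elements.
  bound-critical {n} {m} {C = C} {T = T} {u = u} {L = L} S w<d long | refl , inj₂ (h″ , refl , refl , inj₁ refl) = strict (≤-trans (sub S e e∣n m≤e) e≤L)
    where
    k = 3 + h″
    -- e is half the order of the subgroup generated by g.
    e = suc C * tri (suc k)
    e+e : e + e ≡ suc C * (k * suc k)
    e+e = trans (sym (*-distribˡ-+ (suc C) (tri (suc k)) _)) (cong (suc C *_) (+-cancelʳ-≡ (suc k) _ _ (trans (tri+tri (suc k)) (+-comm (suc k) (k * suc k)))))
    Td≡ : suc T * d S ≡ e + e
    Td≡ = trans (cong (_* d S) (T≡ S)) (trans (lem h″ C) (sym e+e))
      where
      lem : ∀ h C → (3 + h) * suc C * (4 + h + 0 + 0 + 0) ≡ suc C * ((3 + h) * (4 + h))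
      lem = solve-∀
    e∣n : e ∣ n
    e∣n = ∣-trans (∣m∣n⇒∣m+n ∣-refl ∣-refl) (subst (_∣ n) Td≡ (Td∣n S))
    m≤e : m ≤ e
    m≤e = *-cancelˡ-≤ 2 (begin
      2 * m                                                     ≤⟨ m≤m+n (2 * m) _ ⟩
      2 * m + (k * h″ + C * ((1 + h″) * (4 + h″)))              ≡⟨ cong (λ z → 2 * z + (k * h″ + C * ((1 + h″) * (4 + h″)))) (m≡ S) ⟩
      2 * (k + (C * (4 + h″ + 0 + 0 + 0) + 0 + (k + 0 + 0))) + (k * h″ + C * ((1 + h″) * (4 + h″))) ≡⟨ lem h″ C ⟩
      suc C * (k * suc k)                                       ≡⟨ e+e ⟨
      e + e                                                     ≡⟨ cong (e +_) (+-identityʳ e) ⟨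
      2 * e                                                     ∎)
      where
      open ≤-Reasoning
      lem : ∀ h C → 2 * (3 + h + (C * (4 + h + 0 + 0 + 0) + 0 + (3 + h + 0 + 0))) + ((3 + h) * h + C * ((1 + h) * (4 + h)))
                  ≡ suc C * ((3 + h) * (4 + h))
      lem = solve-∀
    -- The count is at least 2 e - h, and h ≤ m ≤ e.
    e≤L : e ≤ L
    e≤L = +-cancelʳ-≤ e e L (begin
      e + e                           ≡⟨ Td≡ ⟨
      suc T * d S                     ≡⟨ lem h″ T ⟩
      T * d S + 1 + k                 ≤⟨ +-monoˡ-≤ k (L≥ S 0 z≤n (s≤s z≤n)) ⟩
      L + k                           ≤⟨ +-monoʳ-≤ L (≤-trans (m≤m+n k _) (≤-trans (≤-reflexive (sym (m≡ S))) m≤e)) ⟩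
      L + e                           ∎)
      where
      open ≤-Reasoning
      lem : ∀ h T → suc T * (4 + h + 0 + 0 + 0) ≡ T * (4 + h + 0 + 0 + 0) + 1 + (3 + h)
      lem = solve-∀
  -- End lengths h + 1 and d = h + 2, so w = d - 2 and h and d have the same parity. For odd h, m +
  -- 2 = (c + 1)(h + 2) and (T + 1) d = h (m - h): exception (iii).
  bound-critical {n} {m} {C = C} {T = T} {u = u} {L = L} S w<d long | refl , inj₂ (h″ , refl , refl , inj₂ refl) with 2 ∣? (3 + h″)
  ... | yes 2∣h = strict (≤-trans (u≤Td S) (even S refl (lem h″) 2∣h (subst (2 ∣_) (lem₂ h″) (∣m∣n⇒∣m+n 2∣h (divides 1 refl)))))
    where
    lem : ∀ h → 3 + suc h + 1 + 0 + 0 ≡ 2 + (3 + h) * (1 + 0)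
    lem = solve-∀
    lem₂ : ∀ h → 3 + h + 2 ≡ 3 + suc h + 1 + 0 + 0
    lem₂ = solve-∀
  ... | no 2∤h = exceptional (≤-trans (u≤Td S) (≤-trans (≤-reflexive (lem h″ T)) (s≤s (L≥ S (w S) ≤-refl (<⇒≤ w<d)))))
      (inj₂ (inj₂ (2∤h , divides (2 + C) (trans (cong (_+ 2) (m≡ S)) (lem₂ h″ C)) , subst (_∣ n) eq (Td∣n S))))
    where
    lem : ∀ h T → suc T * (3 + suc h + 1 + 0 + 0) ≡ suc (T * (3 + suc h + 1 + 0 + 0) + suc ((3 + h) * (1 + 0)))
    lem = solve-∀
    lem₂ : ∀ h C → 3 + h + (C * (3 + suc h + 1 + 0 + 0) + 1 + (3 + h + 1 + 0)) + 2 ≡ (2 + C) * (3 + h + 2)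
    lem₂ = solve-∀
    eq : suc T * (3 + suc h″ + 1 + 0 + 0) ≡ (3 + h″) * m ∸ (3 + h″) * (3 + h″)
    eq = trans (cong (_* (3 + suc h″ + 1 + 0 + 0)) (T≡ S)) (trans (lem₃ h″ C) (trans (sym (m+n∸m≡n ((3 + h″) * (3 + h″)) _))
      (cong (_∸ (3 + h″) * (3 + h″)) (trans (sym (*-distribˡ-+ (3 + h″) (3 + h″) _)) (cong ((3 + h″) *_) (sym (m≡ S)))))))
      where
      lem₃ : ∀ h C → (3 + h) * suc C * (3 + suc h + 1 + 0 + 0) ≡ (3 + h) * (C * (3 + suc h + 1 + 0 + 0) + 1 + (3 + h + 1 + 0))
      lem₃ = solve-∀

  bound-short : ∀ {n m h′ C x r a T u L} (S : ShortSums n m h′ C x r a T u L) → Bound n m (h S) u L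
  bound-short {h′ = h′} {x = x} {r = r} {a = a} {T = T} S with suc (w S) <? d S
  ... | no p = strict (≤-trans (u≤Td S) (≤-trans (≤-reflexive (+-comm (d S) (T * d S))) (L≥ S (2 + h′ + x + r + a) (s≤s⁻¹ (≮⇒≥ p)) ≤-refl)))
  ... | yes w<d with suc x ≤? (1 + h′) * (a + r)
  ...   | yes p = strict (near-interval S 0 w<d p)
  ...   | no p = bound-critical S w<d (s≤s⁻¹ (≰⇒> p) , +-cancelˡ-≤ (2 + (x + r)) _ _ (subst₂ _≤_ (lem h′ (x + r)) (lem₂ h′ x r a) w<d))
    where
    lem : ∀ h y → suc (suc ((2 + h) * y)) ≡ 2 + y + (1 + h) * y
    lem = solve-∀
    lem₂ : ∀ h x r a → 3 + h + x + r + a ≡ 2 + (x + r) + (1 + h + a)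
    lem₂ = solve-∀

-- Each inequality is replaced by an explicit difference, so that the comparisons become polynomial
-- identities without subtraction.
short-bound : ∀ n m h C km kM d T u L → 2 ≤ h → h ≤ km → km ≤ kM → kM < d → m ≡ km + C * d + kM → suc T ≡ h * suc C →
  (∀ e → e ∣ n → m ≤ e → u ≤ e) → (∀ z → m ≡ h + z → u ≤ suc (h * z)) → suc T * d ∣ n → m ≤ suc T * d →
  (∀ v → v ≤ h * (kM ∸ h) → v < d → T * d + suc v ≤ L) →
  (km ≡ kM → d ≡ 2 + h * (kM ∸ h) → 2 ∣ h → 2 ∣ d → suc T * d ≤ L) →
  Bound n m h u L
short-bound n m h C km kM d T u L 2≤h h≤km km≤kM kM<d m≡ T≡ sub u≤ Td∣n m≤ L≥ even
  with m≤n⇒∃[o]m+o≡n 2≤h | m≤n⇒∃[o]m+o≡n h≤km | m≤n⇒∃[o]m+o≡n km≤kM | m≤n⇒∃[o]m+o≡n kM<d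
... | h′ , refl | x , refl | r , refl | a , refl = bound-short {n} {m} {h′} {C} {x} {r} {a} {T} {u} {L} record
  { m≡ = m≡′ ; T≡ = T≡ ; sub = sub ; u≤ = u≤ _ m≡′ ; Td∣n = Td∣n ; m≤ = m≤
  ; L≥ = λ v v≤ → L≥ v (subst (λ y → v ≤ (2 + h′) * y) (sym kM∸h) v≤)
  ; even = λ r≡0 d≡ → even (sym (trans (cong (2 + h′ + x +_) r≡0) (+-identityʳ _))) (trans d≡ (cong (λ y → 2 + (2 + h′) * y) (sym kM∸h)))
  }
  where
  m≡′ : m ≡ 2 + h′ + (C * (3 + h′ + x + r + a) + x + (2 + h′ + x + r))
  m≡′ = trans m≡ (lem h′ x r (C * (3 + h′ + x + r + a)))
    where
    lem : ∀ h x r y → 2 + h + x + y + (2 + h + x + r) ≡ 2 + h + (y + x + (2 + h + x + r))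
    lem = solve-∀
  kM∸h : (2 + h′ + x + r) ∸ (2 + h′) ≡ x + r
  kM∸h = trans (cong (_∸ (2 + h′)) (+-assoc (2 + h′) x r)) (m+n∸m≡n (2 + h′) (x + r))

long-bound : ∀ n m h km kM d T u L → 2 ≤ km → km < h → h ≤ kM → kM < d → m ≡ km + kM → suc T ≡ km →
  u ≤ suc T * d → (∀ z → m ≡ h + z → u ≤ suc (h * z)) → suc T * d ∣ n →
  (∀ v → v ≤ h * (kM ∸ h) → v < d → T * d + suc v ≤ L) →
  (∀ v → v ≤ (h ∸ km) * (kM ∸ (h ∸ km)) → v < d → T * d + suc v ≤ L) →
  Bound n m h u L
long-bound n m h km kM d T u L 2≤km km<h h≤kM kM<d m≡ T≡ u≤Td u≤ Td∣n L≥₁ L≥₂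
  with m≤n⇒∃[o]m+o≡n 2≤km | m≤n⇒∃[o]m+o≡n km<h | m≤n⇒∃[o]m+o≡n h≤kM | m≤n⇒∃[o]m+o≡n kM<d
long-bound n m h km kM d T u L 2≤km km<h h≤kM kM<d m≡ refl u≤Td u≤ Td∣n L≥₁ L≥₂
  | p , refl | y , refl | z , refl | f , refl = bound-long-sums {n} {m} {p} {y} {z} {f} {u} {L} record
  { m≡ = m≡′ ; u≤Td = u≤Td ; u≤ = u≤ _ m≡′ ; Td∣n = Td∣n
  ; L≥₁ = λ v v≤ → L≥₁ v (subst (λ i → v ≤ (3 + p + y) * i) (sym (m+n∸m≡n (3 + p + y) z)) v≤)
  ; L≥₂ = λ v v≤ → L≥₂ v (subst (v ≤_) (sym (trans (cong (λ i → i * (3 + p + y + z ∸ i)) h∸km) (cong (suc y *_) kM∸))) v≤)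
  }
  where
  m≡′ : m ≡ 3 + p + y + (2 + p + z)
  m≡′ = trans m≡ (lem p y z)
    where
    lem : ∀ p y z → 2 + p + (3 + p + y + z) ≡ 3 + p + y + (2 + p + z)
    lem = solve-∀
  h∸km : (3 + p + y) ∸ (2 + p) ≡ suc y
  h∸km = trans (cong (_∸ p) (sym (+-suc p y))) (m+n∸m≡n p (suc y))
  kM∸ : (3 + p + y + z) ∸ suc y ≡ z + (2 + p)
  kM∸ = trans (cong (_∸ y) (lem p y z)) (m+n∸m≡n y (z + (2 + p)))
    where
    lem : ∀ p y z → 2 + p + y + z ≡ y + (z + (2 + p))
    lem = solve-∀

-- Case analysis by the position of h relative to k₁ and k₂.

module Theorem (n : ℕ) .{{_ : NonZero n}} (q d : ℕ) .{{_ : NonZero q}} .{{_ : NonZero d}} (n≡ : n ≡ d * q)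
  (g j₀ C k₁ k₂ h m : ℕ) where

  open Selections n q g
  open IndexedSums n q d n≡ g j₀ C k₁ k₂ h

  N₀ N₁ u L : ℕ
  N₀ = h ∸ k₁
  N₁ = h * C + (h ⊓ k₂)
  u = uHat n m h
  L = length (hHatB n h B)

  module _ (1≤m : 1 ≤ m) (1≤h : 1 ≤ h) (1≤k₁ : 1 ≤ k₁) (1≤k₂ : 1 ≤ k₂)
    (m≡ : m ≡ k₁ + C * d + k₂) (k₁<d : k₁ < d) (k₂<d : k₂ < d) (d<k₁+k₂ : d < k₁ + k₂)
    (card≡ : cardB B ≡ m) (h≤ : h ≤ k₁ ⊔ k₂) where

    open Range 1≤h h≤ k₁<d k₂<d d<k₁+k₂

    sub : ∀ e → e ∣ n → m ≤ e → u ≤ e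
    sub e e∣n m≤e = uHat-≤-subgroup n m h e 1≤m m≤e e∣n

    interval : ∀ z → m ≡ h + z → u ≤ suc (h * z)
    interval z eq = subst (λ y → uHat n y h ≤ suc (h * z)) (sym eq) (uHat-≤-interval n h z)

    N₀<N₁ : N₀ < N₁
    N₀<N₁ with h ≤? k₁
    ... | yes p = subst (_< N₁) (sym (m≤n⇒m∸n≡0 p)) (≤-trans (⊓-glb 1≤h 1≤k₂) (m≤n+m _ (h * C)))
    ... | no p = <-≤-trans (∸-monoʳ-< {h} {k₁} {0} 1≤k₁ (<⇒≤ (≰⇒> p)))
        (≤-trans (≤-reflexive (sym (m≤n⇒m⊓n≡m (fromInj₂ (λ r → contradiction r p) h≤k₁⊎h≤k₂)))) (m≤n+m _ (h * C)))

    module _ (t γ T : ℕ) (q≡ : q ≡ t * γ) (γ∣g : γ ∣ g) (t∣ : ∀ x → q ∣ x * g → t ∣ x)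
      (N₁≡ : N₀ + suc T ≡ N₁) (g-eq : (N₁ * g) % n ≡ (N₀ * g + q) % n) where

      open Counting n q d n≡ g t t∣
      open Sumset j₀ C k₁ k₂ h

      td∣n : t * d ∣ n
      td∣n = divides γ (trans n≡ (trans (cong (d *_) q≡) (lem d t γ)))
        where
        lem : ∀ d t γ → d * (t * γ) ≡ γ * (t * d)
        lem = solve-∀

      m≤td : m ≤ t * d
      m≤td = subst (_≤ t * d) card≡ (cardB-≤ γ q≡ γ∣g)

      u≤td : u ≤ t * d
      u≤td = sub (t * d) td∣n m≤td

      -- k₁ + k₂ > d makes m larger than c d, while m ≤ t d. Once t = T + 1, this rules out h = 1
      -- when T + 1 = h c, and an end length 1 when c = 1 and T + 1 is the shorter end length.
      C<t : suc C < t
      C<t = *-cancelʳ-< d (suc C) t (<-≤-trans (begin-strict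
        d + C * d           <⟨ +-monoˡ-< (C * d) d<k₁+k₂ ⟩
        k₁ + k₂ + C * d     ≡⟨ lem k₁ k₂ (C * d) ⟩
        k₁ + C * d + k₂     ≡⟨ m≡ ⟨
        m                   ∎) m≤td)
        where
        open ≤-Reasoning
        lem : ∀ a b c → a + b + c ≡ a + c + b
        lem = solve-∀

      bound : Bound n m h u L
      bound with t <? suc T
      ... | yes t<T = strict (≤-trans u≤td (length-≥-rows N₀ N₁ T N₁≡ g-eq Full-between t<T))
      ... | no t≮T = go (h ≤? k₁) (h ≤? k₂)
        where
        t≡ : t ≡ suc T
        t≡ = ≤-antisym (∣⇒≤ (t∣suc[T] N₀ N₁ T N₁≡ g-eq)) (≮⇒≥ t≮T)
        Td∣n : suc T * d ∣ n
        Td∣n = subst (λ y → y * d ∣ n) t≡ td∣n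
        m≤Td : m ≤ suc T * d
        m≤Td = subst (λ y → m ≤ y * d) t≡ m≤td
        u≤Td : u ≤ suc T * d
        u≤Td = subst (λ y → u ≤ y * d) t≡ u≤td
        C<suc[T] : suc C < suc T
        C<suc[T] = subst (suc C <_) t≡ C<t
        ≥max : ∀ {s w} v → Sel B h N₁ s w → v ≤ w → v < d → T * d + suc v ≤ L
        ≥max = length-≥-max N₀ N₁ T N₁≡ g-eq Full-between t≡
        ≥min : ∀ {s w} v → Sel B h N₀ s w → v ≤ w → v < d → T * d + suc v ≤ L
        ≥min = length-≥-min N₀ N₁ T N₁≡ g-eq Full-between t≡
        all-rows : (∀ y → (N₁ * g + y * q) % n ∈ hHatB n h B) → Bound n m h u L
        all-rows full = strict (≤-trans u≤Td (≤-trans (≤-reflexive (trans (+-comm d _) (cong (T * d +_) (sym (suc-pred d)))))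
          (length-≥-top N₀ N₁ T N₁≡ g-eq Full-between t≡ 0 (pred d) (≤-reflexive (suc-pred d)) λ r _ → full r)))
        N₀≡0 : h ≤ k₁ → N₀ ≡ 0
        N₀≡0 = m≤n⇒m∸n≡0
        suc[T]≡N₁ : h ≤ k₁ → suc T ≡ N₁
        suc[T]≡N₁ p = trans (cong (_+ suc T) (sym (N₀≡0 p))) N₁≡
        N₁≡hc : h ≤ k₂ → N₁ ≡ h * suc C
        N₁≡hc p = trans (cong (h * C +_) (m≤n⇒m⊓n≡m p)) (trans (+-comm (h * C) h) (sym (*-suc h C)))
        bottom : (p : h ≤ k₁) → Sel B h N₀ (tri h) (h * (k₁ ∸ h))
        bottom p = Sel-cast refl (sym (N₀≡0 p)) (Sel-bottom p)
        top : (p : h ≤ k₂) → Sel B h N₁ (h * j₀ + tri h) (h * (k₂ ∸ h))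
        top p = Sel-cast refl (sym (N₁≡hc p)) (Sel-top p)

        T≡ : h ≤ k₁ → h ≤ k₂ → suc T ≡ h * suc C
        T≡ p₁ p₂ = trans (suc[T]≡N₁ p₁) (N₁≡hc p₂)
        2≤h : h ≤ k₁ → h ≤ k₂ → 2 ≤ h
        2≤h p₁ p₂ = *-cancelʳ-< (suc C) 1 h (subst₂ _<_ (sym (*-identityˡ (suc C))) (T≡ p₁ p₂) C<suc[T])

        short : h ≤ k₁ → h ≤ k₂ → Bound n m h u L
        short p₁ p₂ with ≤-total k₁ k₂
        ... | inj₁ k₁≤k₂ = short-bound n m h C k₁ k₂ d T u L (2≤h p₁ p₂) p₁ k₁≤k₂ k₂<d m≡ (T≡ p₁ p₂)
              sub interval Td∣n m≤Td
              (λ v → ≥max v (top p₂)) even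
          where
          even : k₁ ≡ k₂ → d ≡ 2 + h * (k₂ ∸ h) → 2 ∣ h → 2 ∣ d → suc T * d ≤ L
          even k≡ d≡ 2∣h 2∣d = length-≥-even N₀ N₁ T N₁≡ g-eq Full-between t≡ d≡ 2∣h 2∣d (top p₂)
            (subst (λ k → Sel B h N₀ (tri h) (h * (k ∸ h))) k≡ (bottom p₁))
        ... | inj₂ k₂≤k₁ = short-bound n m h C k₂ k₁ d T u L (2≤h p₁ p₂) p₂ k₂≤k₁ k₁<d m≡′ (T≡ p₁ p₂)
              sub interval Td∣n m≤Td
              (λ v → ≥min v (bottom p₁)) even
          where
          m≡′ : m ≡ k₂ + C * d + k₁
          m≡′ = trans m≡ (lem k₁ (C * d) k₂)
            where
            lem : ∀ a b c → a + b + c ≡ c + b + a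
            lem = solve-∀
          even : k₂ ≡ k₁ → d ≡ 2 + h * (k₁ ∸ h) → 2 ∣ h → 2 ∣ d → suc T * d ≤ L
          even k≡ d≡ 2∣h 2∣d = length-≥-even N₀ N₁ T N₁≡ g-eq Full-between t≡ d≡ 2∣h 2∣d
            (subst (λ k → Sel B h N₁ (h * j₀ + tri h) (h * (k ∸ h))) k≡ (top p₂)) (bottom p₁)

        m≡k₁+k₂ : C ≡ 0 → m ≡ k₁ + k₂
        m≡k₁+k₂ C≡ = trans m≡ (cong (_+ k₂) (trans (cong (λ z → k₁ + z * d) C≡) (+-identityʳ k₁)))
        1<suc[T] : 1 < suc T
        1<suc[T] = ≤-<-trans (s≤s z≤n) C<suc[T]

        -- For c ≥ 2 the top row takes all of B'' and at least one element of the last complete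
        -- coset, so it is complete as well. For c = 1 the bottom row lies within B' alone, and the
        -- top row adds h - k₂ elements of B' to all of B''.
        long-top : h ≤ k₁ → ¬ (h ≤ k₂) → ∀ C′ → C ≡ C′ → Bound n m h u L
        long-top p₁ p₂ (suc C′) C≡ = all-rows (subst Full (cong (h * C +_) (sym (m≥n⇒m⊓n≡n k₂≤h))) (Full-high C≡ k₂ (≰⇒> p₂) ≤-refl))
          where k₂≤h = <⇒≤ (≰⇒> p₂)
        long-top p₁ p₂ zero C≡ = long-bound n m h k₂ k₁ d T u L (subst (1 <_) suc[T]≡ 1<suc[T]) k₂<h p₁ k₁<d
            (trans (m≡k₁+k₂ C≡) (+-comm k₁ k₂)) suc[T]≡ u≤Td interval Td∣n (λ v → ≥min v (bottom p₁))
            (λ v v≤ → ≥max v sl (≤-trans v≤ (m≤m+n _ _)))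
          where
          k₂<h = ≰⇒> p₂
          N₁≡k₂ : N₁ ≡ k₂
          N₁≡k₂ = cong₂ _+_ (trans (cong (h *_) C≡) (*-zeroʳ h)) (m≥n⇒m⊓n≡n (<⇒≤ k₂<h))
          suc[T]≡ : suc T ≡ k₂
          suc[T]≡ = trans (suc[T]≡N₁ p₁) N₁≡k₂
          sl = Sel-cast refl (trans (cong (λ z → k₂ * suc z) C≡) (trans (*-identityʳ k₂) (sym N₁≡k₂)))
            (proj₂ (Sel-ends (h ∸ k₂) k₂ (m∸n+n≡m (<⇒≤ k₂<h)) (≤-trans (m∸n≤m h k₂) p₁) ≤-refl))

        long-bottom : ¬ (h ≤ k₁) → h ≤ k₂ → ∀ C′ → C ≡ C′ → Bound n m h u L
        -- Mirror image: row N₀ is the complete one, and `row-shift` identifies it with row N₁.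
        long-bottom p₁ p₂ (suc C′) C≡ = all-rows λ y → subst (_∈ hHatB n h B) (sym (row-shift N₀ N₁ T N₁≡ g-eq y)) (full (suc y))
          where
          k₁<h = ≰⇒> p₁
          full : Full N₀
          full = Full-low C≡ N₀ (m<n⇒0<n∸m k₁<h) (m∸n≤m h k₁) (≤-reflexive (m∸[m∸n]≡n (<⇒≤ k₁<h)))
        long-bottom p₁ p₂ zero C≡ = long-bound n m h k₁ k₂ d T u L (subst (1 <_) suc[T]≡ 1<suc[T]) k₁<h p₂ k₂<d
            (m≡k₁+k₂ C≡) suc[T]≡ u≤Td interval Td∣n (λ v → ≥max v (top p₂))
            (λ v v≤ → ≥min v sl (≤-trans v≤ (m≤n+m _ _)))
          where
          k₁<h = ≰⇒> p₁
          suc[T]≡ : suc T ≡ k₁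
          suc[T]≡ = +-cancelˡ-≡ N₀ _ _ (trans N₁≡ (trans (N₁≡hc p₂)
            (trans (cong (λ z → h * suc z) C≡) (trans (*-identityʳ h) (sym (m∸n+n≡m (<⇒≤ k₁<h)))))))
          sl = Sel-cast refl (trans (cong (λ z → N₀ * suc z) C≡) (*-identityʳ N₀))
            (proj₂ (Sel-ends k₁ N₀ (m+[n∸m]≡n (<⇒≤ k₁<h)) ≤-refl (≤-trans (m∸n≤m h k₁) p₂)))

        go : Dec (h ≤ k₁) → Dec (h ≤ k₂) → Bound n m h u L
        go (yes p₁) (yes p₂) = short p₁ p₂
        go (yes p₁) (no p₂) = long-top p₁ p₂ C refl
        go (no p₁) (yes p₂) = long-bottom p₁ p₂ C refl
        go (no p₁) (no p₂) with h≤k₁⊎h≤k₂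
        ... | inj₁ p = contradiction p p₁
        ... | inj₂ p = contradiction p p₂

theorem3p1 : (n m h d c k₁ k₂ g j₀ : ℕ) .{{_ : NonZero n}} .{{_ : NonZero d}} →
    1 ≤ m → 1 ≤ h → d ∣ n →
    1 ≤ c → 1 ≤ k₁ → 1 ≤ k₂ →
    m ≡ k₁ + (c ∸ 1) * d + k₂ → k₁ < d → k₂ < d → d < k₁ + k₂ →
    g < n → j₀ < d →
    cardB (Bset n d c k₁ k₂ g j₀) ≡ m →
    (iMax h (Bset n d c k₁ k₂ g j₀) * g) % n
    ≡ (iMin h (Bset n d c k₁ k₂ g j₀) * g + n / d) % n →
    ((∀ r → r ∈ hHatIdx n h (Bset n d c k₁ k₂ g j₀) (iMax h (Bset n d c k₁ k₂ g j₀))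
    → r ∈ hHatIdx n h (Bset n d c k₁ k₂ g j₀) (iMin h (Bset n d c k₁ k₂ g j₀)))
    ⊎ (∀ r → r ∈ hHatIdx n h (Bset n d c k₁ k₂ g j₀) (iMin h (Bset n d c k₁ k₂ g j₀))
    → r ∈ hHatIdx n h (Bset n d c k₁ k₂ g j₀) (iMax h (Bset n d c k₁ k₂ g j₀)))) →
    h ≤ k₁ ⊔ k₂ →
    (uHat n m h ≤ length (hHatB n h (Bset n d c k₁ k₂ g j₀)) + 1)
    × (length (hHatB n h (Bset n d c k₁ k₂ g j₀)) + 1 ≡ uHat n m h →
    (h ≡ 2 × ¬ (∃ λ t → m ∸ 1 ≡ 2 ^ t) × (2 * m ∸ 2) ∣ n)
    ⊎ (h ≡ 3 × m ≡ 6 × 10 ∣ n)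
    ⊎ (¬ (2 ∣ h) × (h + 2) ∣ (m + 2) × (h * m ∸ h * h) ∣ n))
theorem3p1 n m h d (suc C) k₁ k₂ g j₀ 1≤m 1≤h d∣n _ 1≤k₁ 1≤k₂ m≡ k₁<d k₂<d d<k₁+k₂ _ _ card≡ g-eq _ h≤ =
  -- The value `N₁ ∸ suc N₀` given for T is the number of rows strictly between i_min and i_max.
  bound 1≤m 1≤h 1≤k₁ 1≤k₂ m≡ k₁<d k₂<d d<k₁+k₂ card≡ h≤ t γ (N₁ ∸ suc N₀) q≡ γ∣g t∣
    (trans (+-suc N₀ _) (m+[n∸m]≡n (N₀<N₁ 1≤m 1≤h 1≤k₁ 1≤k₂ m≡ k₁<d k₂<d d<k₁+k₂ card≡ h≤)))
    (subst₂ (λ i j → (i * g) % n ≡ (j * g + q) % n) iMax≡ iMin≡ g-eq)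
  where
  q = n / d
  n≡ : n ≡ d * q
  n≡ = sym (m*[n/m]≡n d∣n)
  instance
    q≢0 : NonZero q
    q≢0 = ≢-nonZero λ q≡0 → ≢-nonZero⁻¹ n (trans n≡ (trans (cong (d *_) q≡0) (*-zeroʳ d)))
  open Theorem n q d n≡ g j₀ C k₁ k₂ h m
  open IndexedSums n q d n≡ g j₀ C k₁ k₂ h
  open Range 1≤h h≤ k₁<d k₂<d d<k₁+k₂
  order = order-mod q g
  t = proj₁ order
  γ = proj₁ (proj₂ order)
  q≡ = proj₁ (proj₂ (proj₂ order))
  γ∣g = proj₁ (proj₂ (proj₂ (proj₂ order)))
  t∣ = proj₂ (proj₂ (proj₂ (proj₂ order)))
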